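{- Let $\varphi$ be a positive, non-increasing function defined on the set of positive integers such that $\varphi(1)=1$, $\lim_{q\to+\infty}\varphi(q)=0$ and $\lim_{q\to+\infty} q\varphi(q)=+\infty$. Let $M$ be a positive real number and let $\mathcal{A}$ be a countable subset of $\mathbf{Bad}$ such that the partial quotients of the continued fraction expansion of every element of $\mathcal{A}$ are bounded by $M$. Then there exists an uncountable subset $B_\varphi(\mathcal{A})$ of $\mathbf{Bad}$ such that, for every $\alpha\in\mathcal{A}$ and every $\beta\in B_\varphi(\mathcal{A})$, there exist infinitely many positive integers $q$ with $$q\cdot\Vert q\alpha\Vert\cdot\Vert q\beta\Vert\le\frac{1}{q\cdot\varphi(q)}.$$ Furthermore, the set $B_\varphi(\mathcal{A})$ can be effectively constructed.
   Context: For a real number $x$, $\Vert x\Vert$ denotes the distance from $x$ to the nearest integer. $\mathbf{Bad}=\{\alpha\in\mathbb{R} : \inf_{q\ge1} q\cdot\Vert q\alpha\Vert>0\}$ is the set of badly approximable numbers; equivalently, the set of real numbers whose continued fraction expansion has bounded partial quotients. -}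

module Defs where

open import Data.Bool using (Bool)
open import Data.Integer as ℤ using (ℤ; +_)
import Data.Integer.DivMod as ℤ
import Data.Integer.Properties as ℤ
open import Data.Maybe using (Maybe)
open import Data.Maybe.Relation.Unary.All using (All)
open import Data.Maybe.Relation.Unary.Any using (Any)
open import Data.Nat as ℕ using (ℕ; suc; NonZero)
import Data.Nat.Properties as ℕ
open import Data.Product using (∃; _×_; _,_)
open import Data.Rational as ℚ using (ℚ; 0ℚ; 1ℚ; ½)
import Data.Rational.Properties as ℚ
import Data.Rational.Unnormalised as ℚᵘ
import Data.Rational.Unnormalised.Properties as ℚᵘ
open import Data.Rational.Solver using (module +-*-Solver)
open import Data.Sum using (inj₁; inj₂)
open import Function.Definitions using (Congruent)
open import Level using (0ℓ)
open import Relation.Binary.PropositionalEquality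
open import Relation.Nullary using (¬_)
open import Relation.Unary using (Pred; _∈_)

module Rational where
  open ℚ.≤-Reasoning

  ⟨_⟩ : ℤ → ℚ
  ⟨ k ⟩ = k ℚ./ 1

  ∣p-q∣≡∣q-p∣ : ∀ p q → ℚ.∣ p ℚ.- q ∣ ≡ ℚ.∣ q ℚ.- p ∣
  ∣p-q∣≡∣q-p∣ p q = trans (sym (ℚ.∣-p∣≡∣p∣ (p ℚ.- q)))
    (cong ℚ.∣_∣ (solve 2 (λ p q → :- (p :- q) := q :- p) refl p q))
    where open +-*-Solver

  p≤∣p∣ : ∀ p → p ℚ.≤ ℚ.∣ p ∣
  p≤∣p∣ p with ℚ.≤-total 0ℚ p
  ... | inj₁ 0≤p = ℚ.≤-reflexive (sym (ℚ.0≤p⇒∣p∣≡p 0≤p))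
  ... | inj₂ p≤0 = ℚ.≤-trans p≤0 (ℚ.0≤∣p∣ p)

  -p≤∣p∣ : ∀ p → ℚ.- p ℚ.≤ ℚ.∣ p ∣
  -p≤∣p∣ p = subst (ℚ.- p ℚ.≤_) (ℚ.∣-p∣≡∣p∣ p) (p≤∣p∣ (ℚ.- p))

  ∣p∣≤ : ∀ {p r} → p ℚ.≤ r → ℚ.- p ℚ.≤ r → ℚ.∣ p ∣ ℚ.≤ r
  ∣p∣≤ {p} p≤r -p≤r with ℚ.∣p∣≡p∨∣p∣≡-p p
  ... | inj₁ eq = subst (ℚ._≤ _) (sym eq) p≤r
  ... | inj₂ eq = subst (ℚ._≤ _) (sym eq) -p≤r

  p≤q+r⇒p-q≤r : ∀ p q r → p ℚ.≤ q ℚ.+ r → p ℚ.- q ℚ.≤ r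
  p≤q+r⇒p-q≤r p q r h = begin
    p ℚ.- q           ≤⟨ ℚ.+-monoˡ-≤ (ℚ.- q) h ⟩
    q ℚ.+ r ℚ.- q     ≡⟨ solve 2 (λ q r → q :+ r :- q := r) refl q r ⟩
    r                 ∎
    where open +-*-Solver

  p-q≤r⇒p≤q+r : ∀ p q r → p ℚ.- q ℚ.≤ r → p ℚ.≤ q ℚ.+ r
  p-q≤r⇒p≤q+r p q r h = begin
    p                 ≡⟨ solve 2 (λ p q → p := q :+ (p :- q)) refl p q ⟩
    q ℚ.+ (p ℚ.- q)   ≤⟨ ℚ.+-monoʳ-≤ q h ⟩
    q ℚ.+ r           ∎
    where open +-*-Solver

  q≤∣p-q∣+p : ∀ p q → q ℚ.≤ p ℚ.+ ℚ.∣ p ℚ.- q ∣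
  q≤∣p-q∣+p p q = p-q≤r⇒p≤q+r q p _
    (ℚ.≤-trans (p≤∣p∣ (q ℚ.- p)) (ℚ.≤-reflexive (∣p-q∣≡∣q-p∣ q p)))

  ∣p-q∣≤∣p-r∣+∣r-q∣ : ∀ p r q → ℚ.∣ p ℚ.- q ∣ ℚ.≤ ℚ.∣ p ℚ.- r ∣ ℚ.+ ℚ.∣ r ℚ.- q ∣
  ∣p-q∣≤∣p-r∣+∣r-q∣ p r q = begin
    ℚ.∣ p ℚ.- q ∣                        ≡⟨ cong ℚ.∣_∣ (solve 3 (λ p r q → p :- q := p :- r :+ (r :- q)) refl p r q) ⟩
    ℚ.∣ (p ℚ.- r) ℚ.+ (r ℚ.- q) ∣        ≤⟨ ℚ.∣p+q∣≤∣p∣+∣q∣ (p ℚ.- r) (r ℚ.- q) ⟩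
    ℚ.∣ p ℚ.- r ∣ ℚ.+ ℚ.∣ r ℚ.- q ∣      ∎
    where open +-*-Solver

  -- A map that moves each point up by at most the distance is 1-Lipschitz.
  oneSided⇒lipschitz : (f : ℚ → ℚ) → (∀ p q → f p ℚ.≤ f q ℚ.+ ℚ.∣ p ℚ.- q ∣) →
                       ∀ p q → ℚ.∣ f p ℚ.- f q ∣ ℚ.≤ ℚ.∣ p ℚ.- q ∣
  oneSided⇒lipschitz f h p q = ∣p∣≤
    (p≤q+r⇒p-q≤r (f p) (f q) _ (h p q))
    (begin
      ℚ.- (f p ℚ.- f q)    ≡⟨ solve 2 (λ x y → :- (x :- y) := y :- x) refl (f p) (f q) ⟩
      f q ℚ.- f p          ≤⟨ p≤q+r⇒p-q≤r (f q) (f p) _ (h q p) ⟩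
      ℚ.∣ q ℚ.- p ∣        ≡⟨ ∣p-q∣≡∣q-p∣ q p ⟩
      ℚ.∣ p ℚ.- q ∣        ∎)
    where open +-*-Solver

  ∣∣-lipschitz : ∀ p q → ℚ.∣ ℚ.∣ p ∣ ℚ.- ℚ.∣ q ∣ ∣ ℚ.≤ ℚ.∣ p ℚ.- q ∣
  ∣∣-lipschitz = oneSided⇒lipschitz ℚ.∣_∣ λ p q → begin
    ℚ.∣ p ∣                        ≡⟨ cong ℚ.∣_∣ (solve 2 (λ p q → p := q :+ (p :- q)) refl p q) ⟩
    ℚ.∣ q ℚ.+ (p ℚ.- q) ∣          ≤⟨ ℚ.∣p+q∣≤∣p∣+∣q∣ q (p ℚ.- q) ⟩
    ℚ.∣ q ∣ ℚ.+ ℚ.∣ p ℚ.- q ∣      ∎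
    where open +-*-Solver

  ⊔-lipschitz : ∀ r p q → ℚ.∣ (p ℚ.⊔ r) ℚ.- (q ℚ.⊔ r) ∣ ℚ.≤ ℚ.∣ p ℚ.- q ∣
  ⊔-lipschitz r = oneSided⇒lipschitz (ℚ._⊔ r) λ p q → ℚ.⊔-lub
    (begin
      p                                 ≤⟨ q≤∣p-q∣+p q p ⟩
      q ℚ.+ ℚ.∣ q ℚ.- p ∣               ≡⟨ cong (q ℚ.+_) (∣p-q∣≡∣q-p∣ q p) ⟩
      q ℚ.+ ℚ.∣ p ℚ.- q ∣               ≤⟨ ℚ.+-monoˡ-≤ ℚ.∣ p ℚ.- q ∣ (ℚ.p≤p⊔q q r) ⟩
      (q ℚ.⊔ r) ℚ.+ ℚ.∣ p ℚ.- q ∣       ∎)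
    (begin
      r                                 ≤⟨ ℚ.p≤q⊔p q r ⟩
      q ℚ.⊔ r                           ≡⟨ ℚ.+-identityʳ (q ℚ.⊔ r) ⟨
      (q ℚ.⊔ r) ℚ.+ 0ℚ                  ≤⟨ ℚ.+-monoʳ-≤ (q ℚ.⊔ r) (ℚ.0≤∣p∣ (p ℚ.- q)) ⟩
      (q ℚ.⊔ r) ℚ.+ ℚ.∣ p ℚ.- q ∣       ∎)

  ½>0 : 0ℚ ℚ.< ½
  ½>0 = ℚ.positive⁻¹ ½

  0<p*q : ∀ {p q} → 0ℚ ℚ.< p → 0ℚ ℚ.< q → 0ℚ ℚ.< p ℚ.* q
  0<p*q {p} {q} 0<p 0<q = ℚ.positive⁻¹ (p ℚ.* q) {{ℚ.pos*pos⇒pos p {{ℚ.positive 0<p}} q {{ℚ.positive 0<q}}}}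

  halves : ∀ p → p ℚ.* ½ ℚ.+ p ℚ.* ½ ≡ p
  halves p = trans (sym (ℚ.*-distribˡ-+ p ½ ½)) (ℚ.*-identityʳ p)

  *-mono-≤ : ∀ {p q r s} → 0ℚ ℚ.≤ p → 0ℚ ℚ.≤ s → p ℚ.≤ q → r ℚ.≤ s → p ℚ.* r ℚ.≤ q ℚ.* s
  *-mono-≤ {p} {q} {r} {s} 0≤p 0≤s p≤q r≤s = ℚ.≤-trans
    (ℚ.*-monoˡ-≤-nonNeg p {{ℚ.nonNegative 0≤p}} r≤s)
    (ℚ.*-monoʳ-≤-nonNeg s {{ℚ.nonNegative 0≤s}} p≤q)

  toℚᵘ-⟨⟩ : ∀ k → ℚ.toℚᵘ ⟨ k ⟩ ℚᵘ.≃ ℚᵘ.mkℚᵘ k 0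
  toℚᵘ-⟨⟩ k = ℚ.toℚᵘ-fromℚᵘ (ℚᵘ.mkℚᵘ k 0)

  ⟨⟩-mono : ∀ {j k} → j ℤ.≤ k → ⟨ j ⟩ ℚ.≤ ⟨ k ⟩
  ⟨⟩-mono {j} {k} j≤k = ℚ.toℚᵘ-cancel-≤
    (ℚᵘ.≤-respˡ-≃ (ℚᵘ.≃-sym (toℚᵘ-⟨⟩ j)) (ℚᵘ.≤-respʳ-≃ (ℚᵘ.≃-sym (toℚᵘ-⟨⟩ k))
      (ℚᵘ.*≤* (ℤ.*-monoʳ-≤-nonNeg (+ 1) j≤k))))

  ⟨⟩-pos : ∀ {q} → 0 ℕ.< q → 0ℚ ℚ.< ⟨ + q ⟩
  ⟨⟩-pos {q} 0<q = ℚ.toℚᵘ-cancel-<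
    (ℚᵘ.<-respʳ-≃ (ℚᵘ.≃-sym (toℚᵘ-⟨⟩ (+ q)))
      (ℚᵘ.*<* (ℤ.*-monoʳ-<-pos (+ 1) (ℤ.+<+ 0<q))))

  ⟨⟩-neg : ∀ k → ⟨ ℤ.- k ⟩ ≡ ℚ.- ⟨ k ⟩
  ⟨⟩-neg k = ℚ.toℚᵘ-injective (ℚᵘ.≃-trans (toℚᵘ-⟨⟩ (ℤ.- k))
    (ℚᵘ.≃-sym (ℚᵘ.≃-trans (ℚ.toℚᵘ-homo‿- ⟨ k ⟩) (ℚᵘ.-‿cong (toℚᵘ-⟨⟩ k)))))

  ⌊p⌋≤p : ∀ p → ⟨ ℚ.floor p ⟩ ℚ.≤ p
  ⌊p⌋≤p p@record{} = ℚ.toℚᵘ-cancel-≤ (ℚᵘ.≤-respˡ-≃ (ℚᵘ.≃-sym (toℚᵘ-⟨⟩ (ℚ.floor p)))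
    (ℚᵘ.*≤* (subst (ℚ.floor p ℤ.* ℚ.↧ p ℤ.≤_) (sym (ℤ.*-identityʳ (ℚ.↥ p)))
      (ℤ.[n/d]*d≤n (ℚ.↥ p) (ℚ.↧ p)))))

  i<1+j⇒i≤j : ∀ {i j} → i ℤ.< ℤ.suc j → i ℤ.≤ j
  i<1+j⇒i≤j {i} {j} i<1+j = subst₂ ℤ._≤_ (ℤ.pred-suc i) (ℤ.pred-suc j)
    (ℤ.pred-mono (ℤ.i<j⇒suc[i]≤j i<1+j))

  k≤p⇒k≤⌊p⌋ : ∀ k p → ⟨ k ⟩ ℚ.≤ p → k ℤ.≤ ℚ.floor p
  k≤p⇒k≤⌊p⌋ k p@record{} k≤p with ℚᵘ.≤-respˡ-≃ (toℚᵘ-⟨⟩ k) (ℚ.toℚᵘ-mono-≤ k≤p)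
  ... | ℚᵘ.*≤* kd≤n = subst (k ℤ.≤_) (sym (ℤ.div-pos-is-/ℕ (ℚ.↥ p) (ℚ.↧ₙ p)))
    (i<1+j⇒i≤j (ℤ.*-cancelʳ-<-nonNeg (ℚ.↧ p)
      (ℤ.≤-<-trans (subst (k ℤ.* ℚ.↧ p ℤ.≤_) (ℤ.*-identityʳ (ℚ.↥ p)) kd≤n)
        (ℤ.n<s[n/ℕd]*d (ℚ.↥ p) (ℚ.↧ₙ p)))))

  p≤⌈p⌉ : ∀ p → p ℚ.≤ ⟨ ℚ.ceiling p ⟩
  p≤⌈p⌉ p@record{} = begin
    p                                ≡⟨ solve 1 (λ p → p := :- (:- p)) refl p ⟩
    ℚ.- (ℚ.- p)                      ≤⟨ ℚ.neg-antimono-≤ (⌊p⌋≤p (ℚ.- p)) ⟩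
    ℚ.- ⟨ ℚ.floor (ℚ.- p) ⟩          ≡⟨ ⟨⟩-neg (ℚ.floor (ℚ.- p)) ⟨
    ⟨ ℚ.ceiling p ⟩                  ∎
    where open +-*-Solver

  p≤k⇒⌈p⌉≤k : ∀ k p → p ℚ.≤ ⟨ k ⟩ → ℚ.ceiling p ℤ.≤ k
  p≤k⇒⌈p⌉≤k k p@record{} p≤k = subst (ℚ.ceiling p ℤ.≤_) (ℤ.neg-involutive k)
    (ℤ.neg-mono-≤ (k≤p⇒k≤⌊p⌋ (ℤ.- k) (ℚ.- p)
      (subst (ℚ._≤ ℚ.- p) (sym (⟨⟩-neg k)) (ℚ.neg-antimono-≤ p≤k))))

  -- The nearest integer to p is ⌊p⌋ or ⌈p⌉: see ‖p‖≤∣p-k∣ and ‖p‖-attained.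
  ‖_‖ : ℚ → ℚ
  ‖ p ‖ = (p ℚ.- ⟨ ℚ.floor p ⟩) ℚ.⊓ (⟨ ℚ.ceiling p ⟩ ℚ.- p)

  ‖p‖≤∣p-k∣ : ∀ p k → ‖ p ‖ ℚ.≤ ℚ.∣ p ℚ.- ⟨ k ⟩ ∣
  ‖p‖≤∣p-k∣ p k with ℚ.≤-total ⟨ k ⟩ p
  ... | inj₁ k≤p = begin
    ‖ p ‖                        ≤⟨ ℚ.p⊓q≤p _ _ ⟩
    p ℚ.- ⟨ ℚ.floor p ⟩          ≤⟨ ℚ.+-monoʳ-≤ p (ℚ.neg-antimono-≤ (⟨⟩-mono (k≤p⇒k≤⌊p⌋ k p k≤p))) ⟩
    p ℚ.- ⟨ k ⟩                  ≤⟨ p≤∣p∣ _ ⟩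
    ℚ.∣ p ℚ.- ⟨ k ⟩ ∣            ∎
  ... | inj₂ p≤k = begin
    ‖ p ‖                        ≤⟨ ℚ.p⊓q≤q (p ℚ.- ⟨ ℚ.floor p ⟩) _ ⟩
    ⟨ ℚ.ceiling p ⟩ ℚ.- p        ≤⟨ ℚ.+-monoˡ-≤ (ℚ.- p) (⟨⟩-mono (p≤k⇒⌈p⌉≤k k p p≤k)) ⟩
    ⟨ k ⟩ ℚ.- p                  ≤⟨ p≤∣p∣ _ ⟩
    ℚ.∣ ⟨ k ⟩ ℚ.- p ∣            ≡⟨ ∣p-q∣≡∣q-p∣ ⟨ k ⟩ p ⟩
    ℚ.∣ p ℚ.- ⟨ k ⟩ ∣            ∎

  p≤q⇒∣q-p∣≡q-p : ∀ {p q} → p ℚ.≤ q → ℚ.∣ q ℚ.- p ∣ ≡ q ℚ.- p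
  p≤q⇒∣q-p∣≡q-p {p} {q} p≤q = ℚ.0≤p⇒∣p∣≡p
    (subst (ℚ._≤ q ℚ.- p) (ℚ.+-inverseʳ p) (ℚ.+-monoˡ-≤ (ℚ.- p) p≤q))

  ‖p‖-attained : ∀ p → ∃ λ k → ‖ p ‖ ≡ ℚ.∣ p ℚ.- ⟨ k ⟩ ∣
  ‖p‖-attained p with ℚ.⊓-sel (p ℚ.- ⟨ ℚ.floor p ⟩) (⟨ ℚ.ceiling p ⟩ ℚ.- p)
  ... | inj₁ eq = ℚ.floor p , trans eq (sym (p≤q⇒∣q-p∣≡q-p (⌊p⌋≤p p)))
  ... | inj₂ eq = ℚ.ceiling p , trans eq
    (trans (sym (p≤q⇒∣q-p∣≡q-p (p≤⌈p⌉ p))) (∣p-q∣≡∣q-p∣ ⟨ ℚ.ceiling p ⟩ p))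

  ‖‖-lipschitz : ∀ p q → ℚ.∣ ‖ p ‖ ℚ.- ‖ q ‖ ∣ ℚ.≤ ℚ.∣ p ℚ.- q ∣
  ‖‖-lipschitz = oneSided⇒lipschitz ‖_‖ λ p q → let k , eq = ‖p‖-attained q in begin
    ‖ p ‖                                         ≤⟨ ‖p‖≤∣p-k∣ p k ⟩
    ℚ.∣ p ℚ.- ⟨ k ⟩ ∣                             ≤⟨ ∣p-q∣≤∣p-r∣+∣r-q∣ p q ⟨ k ⟩ ⟩
    ℚ.∣ p ℚ.- q ∣ ℚ.+ ℚ.∣ q ℚ.- ⟨ k ⟩ ∣           ≡⟨ cong (ℚ.∣ p ℚ.- q ∣ ℚ.+_) eq ⟨
    ℚ.∣ p ℚ.- q ∣ ℚ.+ ‖ q ‖                       ≡⟨ ℚ.+-comm ℚ.∣ p ℚ.- q ∣ ‖ q ‖ ⟩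
    ‖ q ‖ ℚ.+ ℚ.∣ p ℚ.- q ∣                       ∎

  inv : ∀ p → 0ℚ ℚ.< p → ℚ
  inv p 0<p = (ℚ.1/ p) {{ℚ.pos⇒nonZero p {{ℚ.positive 0<p}}}}

  inv-pos : ∀ p 0<p → 0ℚ ℚ.< inv p 0<p
  inv-pos p 0<p = ℚ.positive⁻¹ (inv p 0<p) {{ℚ.1/pos⇒pos p {{ℚ.positive 0<p}}}}

  *-inv : ∀ p 0<p → p ℚ.* inv p 0<p ≡ 1ℚ
  *-inv p 0<p = ℚ.*-inverseʳ p {{ℚ.pos⇒nonZero p {{ℚ.positive 0<p}}}}

  *-inv-cancel : ∀ p 0<p r → p ℚ.* (r ℚ.* inv p 0<p) ≡ r
  *-inv-cancel p 0<p r = begin-equality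
    p ℚ.* (r ℚ.* inv p 0<p)      ≡⟨ solve 3 (λ p r i → p :* (r :* i) := r :* (p :* i)) refl p r (inv p 0<p) ⟩
    r ℚ.* (p ℚ.* inv p 0<p)      ≡⟨ cong (r ℚ.*_) (*-inv p 0<p) ⟩
    r ℚ.* 1ℚ                     ≡⟨ ℚ.*-identityʳ r ⟩
    r                            ∎
    where open +-*-Solver

  inv-antimono : ∀ {p q} 0<p 0<q → p ℚ.≤ q → inv q 0<q ℚ.≤ inv p 0<p
  inv-antimono {p} {q} 0<p 0<q p≤q = begin
    inv q 0<q                            ≡⟨ *-inv-cancel p 0<p (inv q 0<q) ⟨
    p ℚ.* (inv q 0<q ℚ.* inv p 0<p)      ≤⟨ ℚ.*-monoʳ-≤-nonNeg _ {{ℚ.nonNegative (ℚ.<⇒≤ (0<p*q (inv-pos q 0<q) (inv-pos p 0<p)))}} p≤q ⟩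
    q ℚ.* (inv q 0<q ℚ.* inv p 0<p)      ≡⟨ cong (q ℚ.*_) (ℚ.*-comm (inv q 0<q) (inv p 0<p)) ⟩
    q ℚ.* (inv p 0<p ℚ.* inv q 0<q)      ≡⟨ *-inv-cancel q 0<q (inv p 0<p) ⟩
    inv p 0<p                            ∎

  0<p⊔ε : ∀ p {ε} → 0ℚ ℚ.< ε → 0ℚ ℚ.< p ℚ.⊔ ε
  0<p⊔ε p {ε} 0<ε = ℚ.<-≤-trans 0<ε (ℚ.p≤q⊔p p ε)

  inv⊔ : ∀ ε → 0ℚ ℚ.< ε → ℚ → ℚ
  inv⊔ ε 0<ε p = inv (p ℚ.⊔ ε) (0<p⊔ε p 0<ε)

  ∣inv⊔∣≤ : ∀ ε 0<ε p → ℚ.∣ inv⊔ ε 0<ε p ∣ ℚ.≤ inv ε 0<ε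
  ∣inv⊔∣≤ ε 0<ε p = begin
    ℚ.∣ inv⊔ ε 0<ε p ∣    ≡⟨ ℚ.0≤p⇒∣p∣≡p (ℚ.<⇒≤ (inv-pos (p ℚ.⊔ ε) (0<p⊔ε p 0<ε))) ⟩
    inv⊔ ε 0<ε p          ≤⟨ inv-antimono 0<ε (0<p⊔ε p 0<ε) (ℚ.p≤q⊔p p ε) ⟩
    inv ε 0<ε             ∎

  inv⊔-lipschitz : ∀ ε 0<ε p q → ℚ.∣ inv⊔ ε 0<ε p ℚ.- inv⊔ ε 0<ε q ∣ ℚ.≤
                                 (inv ε 0<ε ℚ.* inv ε 0<ε) ℚ.* ℚ.∣ p ℚ.- q ∣
  inv⊔-lipschitz ε 0<ε p q = begin
    ℚ.∣ i ℚ.- j ∣                                    ≡⟨ cong₂ (λ u v → ℚ.∣ u ℚ.- v ∣) (*-inv-cancel b 0<b i) (*-inv-cancel a 0<a j) ⟨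
    ℚ.∣ b ℚ.* (i ℚ.* j) ℚ.- a ℚ.* (j ℚ.* i) ∣        ≡⟨ cong ℚ.∣_∣ (solve 4 (λ a b i j → b :* (i :* j) :- a :* (j :* i) := i :* j :* (b :- a)) refl a b i j) ⟩
    ℚ.∣ i ℚ.* j ℚ.* (b ℚ.- a) ∣                      ≡⟨ ℚ.∣p*q∣≡∣p∣*∣q∣ (i ℚ.* j) (b ℚ.- a) ⟩
    ℚ.∣ i ℚ.* j ∣ ℚ.* ℚ.∣ b ℚ.- a ∣                  ≤⟨ *-mono-≤ (ℚ.0≤∣p∣ (i ℚ.* j)) (ℚ.0≤∣p∣ (p ℚ.- q)) ∣ij∣≤ ∣b-a∣≤ ⟩
    (e ℚ.* e) ℚ.* ℚ.∣ p ℚ.- q ∣                      ∎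
    where
    open +-*-Solver
    a = p ℚ.⊔ ε
    b = q ℚ.⊔ ε
    0<a = 0<p⊔ε p 0<ε
    0<b = 0<p⊔ε q 0<ε
    i = inv a 0<a
    j = inv b 0<b
    e = inv ε 0<ε
    ∣ij∣≤ : ℚ.∣ i ℚ.* j ∣ ℚ.≤ e ℚ.* e
    ∣ij∣≤ = ℚ.≤-trans (ℚ.≤-reflexive (ℚ.∣p*q∣≡∣p∣*∣q∣ i j))
      (*-mono-≤ (ℚ.0≤∣p∣ i) (ℚ.<⇒≤ (inv-pos ε 0<ε)) (∣inv⊔∣≤ ε 0<ε p) (∣inv⊔∣≤ ε 0<ε q))
    ∣b-a∣≤ : ℚ.∣ b ℚ.- a ∣ ℚ.≤ ℚ.∣ p ℚ.- q ∣
    ∣b-a∣≤ = ℚ.≤-trans (ℚ.≤-reflexive (∣p-q∣≡∣q-p∣ b a)) (⊔-lipschitz ε p q)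

  ∣p*q-r*s∣≤ : ∀ p q r s → ℚ.∣ p ℚ.* q ℚ.- r ℚ.* s ∣ ℚ.≤
                          ℚ.∣ p ∣ ℚ.* ℚ.∣ q ℚ.- s ∣ ℚ.+ ℚ.∣ s ∣ ℚ.* ℚ.∣ p ℚ.- r ∣
  ∣p*q-r*s∣≤ p q r s = begin
    ℚ.∣ p ℚ.* q ℚ.- r ℚ.* s ∣                                      ≡⟨ cong ℚ.∣_∣ (solve 4 (λ p q r s → p :* q :- r :* s := p :* (q :- s) :+ s :* (p :- r)) refl p q r s) ⟩
    ℚ.∣ p ℚ.* (q ℚ.- s) ℚ.+ s ℚ.* (p ℚ.- r) ∣                      ≤⟨ ℚ.∣p+q∣≤∣p∣+∣q∣ (p ℚ.* (q ℚ.- s)) (s ℚ.* (p ℚ.- r)) ⟩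
    ℚ.∣ p ℚ.* (q ℚ.- s) ∣ ℚ.+ ℚ.∣ s ℚ.* (p ℚ.- r) ∣                ≡⟨ cong₂ ℚ._+_ (ℚ.∣p*q∣≡∣p∣*∣q∣ p (q ℚ.- s)) (ℚ.∣p*q∣≡∣p∣*∣q∣ s (p ℚ.- r)) ⟩
    ℚ.∣ p ∣ ℚ.* ℚ.∣ q ℚ.- s ∣ ℚ.+ ℚ.∣ s ∣ ℚ.* ℚ.∣ p ℚ.- r ∣        ∎
    where open +-*-Solver

open Rational using (⟨_⟩)

-- Cauchy sequences with a modulus of convergence, so every x : ℝ can be computed
-- to any given accuracy.
record ℝ : Set where
  field
    seq    : ℕ → ℚ
    cauchy : ∀ ε → 0ℚ ℚ.< ε → ∃ λ N → ∀ m n → N ℕ.≤ m → N ℕ.≤ n →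
             ℚ.∣ seq m ℚ.- seq n ∣ ℚ.≤ ε

open ℝ public

infix 4 _≃_ _≤_ _<_

_≃_ : ℝ → ℝ → Set
x ≃ y = ∀ ε → 0ℚ ℚ.< ε → ∃ λ N → ∀ n → N ℕ.≤ n → ℚ.∣ seq x n ℚ.- seq y n ∣ ℚ.≤ ε

_≤_ : ℝ → ℝ → Set
x ≤ y = ∀ ε → 0ℚ ℚ.< ε → ∃ λ N → ∀ n → N ℕ.≤ n → seq x n ℚ.≤ seq y n ℚ.+ ε

_<_ : ℝ → ℝ → Set
x < y = ∃ λ ε → 0ℚ ℚ.< ε × ∃ λ N → ∀ n → N ℕ.≤ n → seq x n ℚ.+ ε ℚ.≤ seq y n

fromℚ : ℚ → ℝ
fromℚ p .seq _ = p
fromℚ p .cauchy ε 0<ε = 0 , λ _ _ _ _ →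
  subst (ℚ._≤ ε) (sym (cong ℚ.∣_∣ (ℚ.+-inverseʳ p))) (ℚ.<⇒≤ 0<ε)

fromℤ : ℤ → ℝ
fromℤ k = fromℚ ⟨ k ⟩

fromℕ : ℕ → ℝ
fromℕ n = fromℤ (+ n)

0ℝ 1ℝ : ℝ
0ℝ = fromℚ 0ℚ
1ℝ = fromℚ 1ℚ

module _ where
  open Rational hiding (‖_‖)
  open ℚ.≤-Reasoning

  lipschitz : (f : ℚ → ℚ) (C : ℚ) → 0ℚ ℚ.< C →
              (∀ p q → ℚ.∣ f p ℚ.- f q ∣ ℚ.≤ C ℚ.* ℚ.∣ p ℚ.- q ∣) → ℝ → ℝ
  lipschitz f C 0<C f-lip x .seq n = f (seq x n)
  lipschitz f C 0<C f-lip x .cauchy ε 0<ε =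
    let N , h = cauchy x (ε ℚ.* inv C 0<C) (0<p*q 0<ε (inv-pos C 0<C))
    in N , λ m n N≤m N≤n → begin
      ℚ.∣ f (seq x m) ℚ.- f (seq x n) ∣      ≤⟨ f-lip (seq x m) (seq x n) ⟩
      C ℚ.* ℚ.∣ seq x m ℚ.- seq x n ∣        ≤⟨ ℚ.*-monoˡ-≤-nonNeg C {{ℚ.nonNegative (ℚ.<⇒≤ 0<C)}} (h m n N≤m N≤n) ⟩
      C ℚ.* (ε ℚ.* inv C 0<C)                ≡⟨ *-inv-cancel C 0<C ε ⟩
      ε                                      ∎

  lipschitz₁ : (f : ℚ → ℚ) → (∀ p q → ℚ.∣ f p ℚ.- f q ∣ ℚ.≤ ℚ.∣ p ℚ.- q ∣) → ℝ → ℝ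
  lipschitz₁ f f-lip = lipschitz f 1ℚ (ℚ.positive⁻¹ 1ℚ) λ p q →
    subst (ℚ.∣ f p ℚ.- f q ∣ ℚ.≤_) (sym (ℚ.*-identityˡ ℚ.∣ p ℚ.- q ∣)) (f-lip p q)

  bounded : ∀ x → ∃ λ K → 0ℚ ℚ.< K × ∃ λ N → ∀ n → N ℕ.≤ n → ℚ.∣ seq x n ∣ ℚ.≤ K
  bounded x =
    let 0<1 = ℚ.positive⁻¹ 1ℚ
        N , h = cauchy x 1ℚ 0<1
        a = seq x N
    in ℚ.∣ a ∣ ℚ.+ 1ℚ , ℚ.+-mono-≤-< (ℚ.0≤∣p∣ a) 0<1 , N , λ n N≤n → p-q≤r⇒p≤q+r ℚ.∣ seq x n ∣ ℚ.∣ a ∣ 1ℚ (begin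
      ℚ.∣ seq x n ∣ ℚ.- ℚ.∣ a ∣                  ≤⟨ p≤∣p∣ _ ⟩
      ℚ.∣ ℚ.∣ seq x n ∣ ℚ.- ℚ.∣ a ∣ ∣            ≤⟨ ∣∣-lipschitz (seq x n) a ⟩
      ℚ.∣ seq x n ℚ.- a ∣                        ≤⟨ h n N N≤n ℕ.≤-refl ⟩
      1ℚ                                         ∎)

  infixl 6 _+_ _-_
  infixl 7 _*_
  infix 8 -_

  _+_ : ℝ → ℝ → ℝ
  (x + y) .seq n = seq x n ℚ.+ seq y n
  (x + y) .cauchy ε 0<ε =
    let 0<ε/2 = 0<p*q 0<ε ½>0
        N , f = cauchy x (ε ℚ.* ½) 0<ε/2
        N′ , g = cauchy y (ε ℚ.* ½) 0<ε/2
    in N ℕ.⊔ N′ , λ m n N≤m N≤n →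
      let a = seq x m ; b = seq y m ; c = seq x n ; d = seq y n in begin
      ℚ.∣ (a ℚ.+ b) ℚ.- (c ℚ.+ d) ∣            ≡⟨ cong ℚ.∣_∣ (solve 4 (λ a b c d → a :+ b :- (c :+ d) := a :- c :+ (b :- d)) refl a b c d) ⟩
      ℚ.∣ (a ℚ.- c) ℚ.+ (b ℚ.- d) ∣            ≤⟨ ℚ.∣p+q∣≤∣p∣+∣q∣ (a ℚ.- c) (b ℚ.- d) ⟩
      ℚ.∣ a ℚ.- c ∣ ℚ.+ ℚ.∣ b ℚ.- d ∣          ≤⟨ ℚ.+-mono-≤ (f m n (ℕ.m⊔n≤o⇒m≤o N N′ N≤m) (ℕ.m⊔n≤o⇒m≤o N N′ N≤n))
                                                             (g m n (ℕ.m⊔n≤o⇒n≤o N N′ N≤m) (ℕ.m⊔n≤o⇒n≤o N N′ N≤n)) ⟩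
      ε ℚ.* ½ ℚ.+ ε ℚ.* ½                      ≡⟨ halves ε ⟩
      ε                                        ∎
    where open +-*-Solver using (solve; _:=_; _:+_; _:-_)

  -_ : ℝ → ℝ
  -_ = lipschitz₁ ℚ.-_ λ p q → ℚ.≤-reflexive
    (trans (cong ℚ.∣_∣ (solve 2 (λ p q → :- p :- :- q := q :- p) refl p q)) (∣p-q∣≡∣q-p∣ q p))
    where open +-*-Solver

  _-_ : ℝ → ℝ → ℝ
  x - y = x + - y

  _*_ : ℝ → ℝ → ℝ
  (x * y) .seq n = seq x n ℚ.* seq y n
  (x * y) .cauchy ε 0<ε =
    let K , 0<K , N₁ , f = bounded x
        L , 0<L , N₂ , g = bounded y
        0<ε/2 = 0<p*q 0<ε ½>0
        N₃ , h = cauchy x (ε ℚ.* ½ ℚ.* inv L 0<L) (0<p*q 0<ε/2 (inv-pos L 0<L))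
        N₄ , k = cauchy y (ε ℚ.* ½ ℚ.* inv K 0<K) (0<p*q 0<ε/2 (inv-pos K 0<K))
        N = N₁ ℕ.⊔ N₂
        N′ = N₃ ℕ.⊔ N₄
    in N ℕ.⊔ N′ , λ m n ≤m ≤n →
      let a = seq x m ; b = seq y m ; c = seq x n ; d = seq y n
          N≤m = ℕ.m⊔n≤o⇒m≤o N N′ ≤m ; N′≤m = ℕ.m⊔n≤o⇒n≤o N N′ ≤m
          N≤n = ℕ.m⊔n≤o⇒m≤o N N′ ≤n ; N′≤n = ℕ.m⊔n≤o⇒n≤o N N′ ≤n
      in begin
      ℚ.∣ a ℚ.* b ℚ.- c ℚ.* d ∣
        ≤⟨ ∣p*q-r*s∣≤ a b c d ⟩
      ℚ.∣ a ∣ ℚ.* ℚ.∣ b ℚ.- d ∣ ℚ.+ ℚ.∣ d ∣ ℚ.* ℚ.∣ a ℚ.- c ∣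
        ≤⟨ ℚ.+-mono-≤
             (*-mono-≤ (ℚ.0≤∣p∣ a) (ℚ.<⇒≤ (0<p*q 0<ε/2 (inv-pos K 0<K)))
               (f m (ℕ.m⊔n≤o⇒m≤o N₁ N₂ N≤m)) (k m n (ℕ.m⊔n≤o⇒n≤o N₃ N₄ N′≤m) (ℕ.m⊔n≤o⇒n≤o N₃ N₄ N′≤n)))
             (*-mono-≤ (ℚ.0≤∣p∣ d) (ℚ.<⇒≤ (0<p*q 0<ε/2 (inv-pos L 0<L)))
               (g n (ℕ.m⊔n≤o⇒n≤o N₁ N₂ N≤n)) (h m n (ℕ.m⊔n≤o⇒m≤o N₃ N₄ N′≤m) (ℕ.m⊔n≤o⇒m≤o N₃ N₄ N′≤n))) ⟩
      K ℚ.* (ε ℚ.* ½ ℚ.* inv K 0<K) ℚ.+ L ℚ.* (ε ℚ.* ½ ℚ.* inv L 0<L)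
        ≡⟨ cong₂ ℚ._+_ (*-inv-cancel K 0<K (ε ℚ.* ½)) (*-inv-cancel L 0<L (ε ℚ.* ½)) ⟩
      ε ℚ.* ½ ℚ.+ ε ℚ.* ½
        ≡⟨ halves ε ⟩
      ε ∎

  ∣_∣ : ℝ → ℝ
  ∣_∣ = lipschitz₁ ℚ.∣_∣ ∣∣-lipschitz

  -- Distance to the nearest integer, the continuous extension of the function on ℚ.
  ‖_‖ : ℝ → ℝ
  ‖_‖ = lipschitz₁ Rational.‖_‖ ‖‖-lipschitz

  -- If ε > 0 is a rational eventually below the terms of x, then the terms of x
  -- are eventually equal to their maximum with ε.
  recip : ∀ x → 0ℝ < x → ℝ
  recip x (ε , 0<ε , _) = lipschitz (inv⊔ ε 0<ε) (inv ε 0<ε ℚ.* inv ε 0<ε)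
    (0<p*q (inv-pos ε 0<ε) (inv-pos ε 0<ε)) (inv⊔-lipschitz ε 0<ε) x

  0<x*y : ∀ {x y} → 0ℝ < x → 0ℝ < y → 0ℝ < x * y
  0<x*y {x} {y} (ε , 0<ε , N , f) (δ , 0<δ , N′ , g) =
    ε ℚ.* δ , 0<p*q 0<ε 0<δ , N ℕ.⊔ N′ , λ n ≤n →
      let ε≤x = subst (ℚ._≤ seq x n) (ℚ.+-identityˡ ε) (f n (ℕ.m⊔n≤o⇒m≤o N N′ ≤n))
          δ≤y = subst (ℚ._≤ seq y n) (ℚ.+-identityˡ δ) (g n (ℕ.m⊔n≤o⇒n≤o N N′ ≤n))
      in begin
      0ℚ ℚ.+ ε ℚ.* δ          ≡⟨ ℚ.+-identityˡ (ε ℚ.* δ) ⟩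
      ε ℚ.* δ                 ≤⟨ *-mono-≤ (ℚ.<⇒≤ 0<ε) (ℚ.≤-trans (ℚ.<⇒≤ 0<δ) δ≤y) ε≤x δ≤y ⟩
      seq x n ℚ.* seq y n     ∎

  x<y⇒0<y-x : ∀ {x y} → x < y → 0ℝ < y - x
  x<y⇒0<y-x {x} {y} (ε , 0<ε , N , f) = ε , 0<ε , N , λ n N≤n →
    let a = seq x n ; b = seq y n in begin
    0ℚ ℚ.+ ε            ≡⟨ solve 2 (λ a ε → con 0ℚ :+ ε := a :+ ε :- a) refl a ε ⟩
    a ℚ.+ ε ℚ.- a       ≤⟨ ℚ.+-monoˡ-≤ (ℚ.- a) (f n N≤n) ⟩
    b ℚ.- a             ∎
    where open +-*-Solver

  0<q : ∀ q .{{_ : NonZero q}} → 0ℝ < fromℕ q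
  0<q q = ⟨ + q ⟩ , ⟨⟩-pos (ℕ.>-nonZero⁻¹ q) , 0 , λ _ _ → ℚ.≤-reflexive (ℚ.+-identityˡ ⟨ + q ⟩)

Sequence : Set
Sequence = (q : ℕ) → .{{NonZero q}} → ℝ

_⟶_ : Sequence → ℝ → Set
f ⟶ l = ∀ ε → 0ℝ < ε → ∃ λ N → ∀ q .{{_ : NonZero q}} → N ℕ.≤ q → ∣ f q - l ∣ < ε

_⟶+∞ : Sequence → Set
f ⟶+∞ = ∀ K → ∃ λ N → ∀ q .{{_ : NonZero q}} → N ℕ.≤ q → K < f q

-- Unboundedly many; q is written suc n to make it positive.
InfinitelyManyPositive : ((q : ℕ) → .{{NonZero q}} → Set) → Set
InfinitelyManyPositive P = ∀ N → ∃ λ n → N ℕ.≤ n × P (suc n)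

-- The infimum of q‖qα‖ over q ≥ 1 is positive iff some positive real is a lower
-- bound; constructively the infimum itself need not exist as an element of ℝ.
Bad : Pred ℝ 0ℓ
Bad α = ∃ λ c → 0ℝ < c × ∀ q .{{_ : NonZero q}} → c ≤ fromℕ q * ‖ fromℕ q * α ‖

-- The infinite expansion α = [a 0; a 1, a 2, …] of an irrational α, given by the
-- complete quotients ξ 0 = α, ξ (n + 1) = 1 / (ξ n - a n) with a n = ⌊ξ n⌋.  The
-- lower bound on ξ n is strict because ξ n is irrational.
record _HasContinuedFraction_ (α : ℝ) (a : ℕ → ℤ) : Set where
  field
    ξ      : ℕ → ℝ
    ξ-zero : ξ 0 ≃ α
    a<ξ    : ∀ n → fromℤ (a n) < ξ n
    ξ<a+1  : ∀ n → ξ n < fromℤ (a n) + 1ℝ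
    ξ-suc  : ∀ n → ξ (suc n) ≃ recip (ξ n - fromℤ (a n)) (x<y⇒0<y-x {fromℤ (a n)} {ξ n} (a<ξ n))

-- The integer part a 0 is not counted among the partial quotients.
PartialQuotientsBoundedBy : ℝ → Pred ℝ 0ℓ
PartialQuotientsBoundedBy M α =
  ∃ λ a → α HasContinuedFraction a × ∀ n → fromℤ (a (suc n)) ≤ M

-- Finite (possibly empty) or countably infinite: an enumeration may skip indices
-- and repeat elements.
Countable : Pred ℝ 0ℓ → Set
Countable A = ∃ λ (e : ℕ → Maybe ℝ) →
  (∀ n → All (_∈ A) (e n)) ×
  (∀ x → x ∈ A → ∃ λ n → Any (_≃ x) (e n))

Uncountable : Pred ℝ 0ℓ → Set
Uncountable A = ¬ Countable A

-- A procedure turns each infinite sequence of binary choices into an element of A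
-- (that is, into rational approximations with a modulus of convergence), and
-- produces every element of A.
EffectivelyConstructed : Pred ℝ 0ℓ → Set
EffectivelyConstructed A = ∃ λ (F : (ℕ → Bool) → ℝ) →
  Congruent _≗_ _≃_ F ×
  (∀ s → F s ∈ A) ×
  (∀ x → x ∈ A → ∃ λ s → F s ≃ x)

module Submission where

-- Let α = [a₀; a₁, a₂, …] and let q be the denominator of the convergent of β whose
-- digits are a word w followed by a_k, …, a₁.  By the mirror formula the ratio of
-- the preceding denominator to q is [0; a₁, …, a_k, …], which agrees with α - a₀ so
-- well that q‖qα‖ is bounded by 2 q_w² + 1, independently of k, while q‖qβ‖ ≤ 1.
-- For k so large that φ(q) ≤ 1 / (2 q_w² + 1) this gives the inequality.  The
-- digits of β are such reversed blocks, visiting every α of the countable set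
-- infinitely often, interleaved with free digits 1 or 3, which code an arbitrary
-- binary sequence.

open import Data.Bool using (Bool; true; false; not)
open import Data.Bool.Properties using (not-¬)
open import Data.Integer as ℤ using (ℤ; +_)
import Data.Integer.Properties as ℤ
open import Data.List using (List; []; _∷_; _++_; length; applyUpTo)
open import Data.List.Properties using (++-assoc; length-++; length-applyUpTo)
open import Data.List.Relation.Unary.All as All using (All; []; _∷_)
open import Data.List.Relation.Unary.All.Properties using (++⁺; ++⁻ˡ; ++⁻ʳ; applyUpTo⁺₂)
open import Data.Maybe using (Maybe; just; nothing)
open import Data.Maybe.Relation.Unary.All as Maybe using (just; nothing)
open import Data.Maybe.Relation.Unary.Any as Maybe using (just)
open import Data.Nat as ℕ using (ℕ; zero; suc; NonZero)
import Data.Nat.Properties as ℕ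
import Data.Nat.Tactic.RingSolver as ℕ
open import Data.Product using (∃; _×_; _,_; proj₁; proj₂)
open import Data.Rational as ℚ using (ℚ; 0ℚ; 1ℚ; ½)
import Data.Rational.Properties as ℚ
open import Data.Rational.Solver using (module +-*-Solver)
import Data.Rational.Unnormalised as ℚᵘ
import Data.Rational.Unnormalised.Properties as ℚᵘ
open import Function using (_∘_)
open import Function.Definitions using (Congruent)
open import Level using (0ℓ)
open import Relation.Binary.Definitions using (_Respects_)
open import Relation.Binary.PropositionalEquality
open import Relation.Nullary using (¬_; Dec; yes; no; contradiction)
open import Relation.Unary using (Pred; _∈_; _⊆_)
open import Defs using (module Rational; ℝ; seq; cauchy; _≃_; Bad; 0ℝ; recip; fromℤ;
  _HasContinuedFraction_; x<y⇒0<y-x; bounded)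

-- Blocks may have to be very long, because nothing is known about the rate at which φ tends to 0,
-- yet β must stay badly approximable. It does, since all its digits lie between 1 and a single `K`,
-- whatever the lengths: a fraction k/n is compared with two successive convergents whose
-- denominators straddle 2n, and it cannot equal both. A block length depends on the preceding word
-- alone, so two coding sequences yield the same digits up to the first bit in which they differ.
-- This makes the coding injective and the construction explicit. All estimates are made on rational
-- terms: the terms of β are convergents of β, and the bounds are uniform in the digits still to
-- come, so no limit ever has to be evaluated.

-- Integers inside the rationals, `≃`, and the stability of `Bad`.

module Arithmetic where
  open import Data.Rational using (_+_; _-_; _*_; -_; _≤_; _<_; ∣_∣)
  open Rational hiding (‖_‖)
  open ℚ.≤-Reasoning
  open +-*-Solver using (solve; _:=_; _:+_; _:*_; _:-_; :-_; con)

  ⟨⟩-+ : ∀ j k → ⟨ j ℤ.+ k ⟩ ≡ ⟨ j ⟩ + ⟨ k ⟩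
  ⟨⟩-+ j k = ℚ.toℚᵘ-injective (ℚᵘ.≃-trans (toℚᵘ-⟨⟩ (j ℤ.+ k)) (ℚᵘ.≃-sym
    (ℚᵘ.≃-trans (ℚ.toℚᵘ-homo-+ ⟨ j ⟩ ⟨ k ⟩) (ℚᵘ.≃-trans (ℚᵘ.+-cong (toℚᵘ-⟨⟩ j) (toℚᵘ-⟨⟩ k))
      (ℚᵘ.*≡* (cong (ℤ._* + 1) (cong₂ ℤ._+_ (ℤ.*-identityʳ j) (ℤ.*-identityʳ k))))))))

  ⟨⟩-* : ∀ j k → ⟨ j ℤ.* k ⟩ ≡ ⟨ j ⟩ * ⟨ k ⟩
  ⟨⟩-* j k = ℚ.toℚᵘ-injective (ℚᵘ.≃-trans (toℚᵘ-⟨⟩ (j ℤ.* k)) (ℚᵘ.≃-sym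
    (ℚᵘ.≃-trans (ℚ.toℚᵘ-homo-* ⟨ j ⟩ ⟨ k ⟩) (ℚᵘ.≃-trans (ℚᵘ.*-cong (toℚᵘ-⟨⟩ j) (toℚᵘ-⟨⟩ k)) (ℚᵘ.*≡* refl)))))

  ⟨⟩-minus : ∀ j k → ⟨ j ℤ.- k ⟩ ≡ ⟨ j ⟩ - ⟨ k ⟩
  ⟨⟩-minus j k = trans (⟨⟩-+ j (ℤ.- k)) (cong (λ z → ⟨ j ⟩ + z) (⟨⟩-neg k))

  ι : ℕ → ℚ
  ι n = ⟨ + n ⟩

  ι-+ : ∀ m n → ι (m ℕ.+ n) ≡ ι m + ι n
  ι-+ m n = trans (cong ⟨_⟩ (ℤ.pos-+ m n)) (⟨⟩-+ (+ m) (+ n))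

  ι-* : ∀ m n → ι (m ℕ.* n) ≡ ι m * ι n
  ι-* m n = trans (cong ⟨_⟩ (ℤ.pos-* m n)) (⟨⟩-* (+ m) (+ n))

  ι-mono : ∀ {m n} → m ℕ.≤ n → ι m ≤ ι n
  ι-mono m≤n = ⟨⟩-mono (ℤ.+≤+ m≤n)

  0≤ι : ∀ n → 0ℚ ≤ ι n
  0≤ι n = ι-mono {0} {n} ℕ.z≤n

  1≤∣⟨⟩∣ : ∀ k → k ≢ + 0 → 1ℚ ≤ ∣ ⟨ k ⟩ ∣
  1≤∣⟨⟩∣ (+ zero)    k≢0 = contradiction refl k≢0
  1≤∣⟨⟩∣ (+ suc n)   k≢0 = ℚ.≤-trans (ι-mono {1} {suc n} (ℕ.s≤s ℕ.z≤n)) (p≤∣p∣ (ι (suc n)))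
  1≤∣⟨⟩∣ (ℤ.-[1+ n ]) k≢0 = begin
    1ℚ                      ≤⟨ ι-mono {1} {suc n} (ℕ.s≤s ℕ.z≤n) ⟩
    ι (suc n)               ≤⟨ p≤∣p∣ (ι (suc n)) ⟩
    ∣ ι (suc n) ∣           ≡⟨ ℚ.∣-p∣≡∣p∣ (ι (suc n)) ⟨
    ∣ - ι (suc n) ∣         ≡⟨ cong ∣_∣ (⟨⟩-neg (+ suc n)) ⟨
    ∣ ⟨ ℤ.-[1+ n ] ⟩ ∣      ∎

  *-monoˡ : ∀ {p q} r → 0ℚ ≤ r → p ≤ q → r * p ≤ r * q
  *-monoˡ r 0≤r = ℚ.*-monoˡ-≤-nonNeg r {{ℚ.nonNegative 0≤r}}

  *-monoʳ : ∀ {p q} r → 0ℚ ≤ r → p ≤ q → p * r ≤ q * r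
  *-monoʳ r 0≤r = ℚ.*-monoʳ-≤-nonNeg r {{ℚ.nonNegative 0≤r}}

  *-cancelˡ : ∀ {p q} r → 0ℚ < r → r * p ≤ r * q → p ≤ q
  *-cancelˡ r 0<r = ℚ.*-cancelˡ-≤-pos r {{ℚ.positive 0<r}}

  0≤p*q : ∀ {p q} → 0ℚ ≤ p → 0ℚ ≤ q → 0ℚ ≤ p * q
  0≤p*q {p} {q} 0≤p 0≤q = begin
    0ℚ          ≡⟨ ℚ.*-zeroʳ p ⟨
    p * 0ℚ      ≤⟨ *-monoˡ p 0≤p 0≤q ⟩
    p * q       ∎

  ∣p*q∣≡p*∣q∣ : ∀ {p} q → 0ℚ ≤ p → ∣ p * q ∣ ≡ p * ∣ q ∣
  ∣p*q∣≡p*∣q∣ {p} q 0≤p = trans (ℚ.∣p*q∣≡∣p∣*∣q∣ p q) (cong (_* ∣ q ∣) (ℚ.0≤p⇒∣p∣≡p 0≤p))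

  p≤p+q : ∀ {p q} → 0ℚ ≤ q → p ≤ p + q
  p≤p+q {p} {q} 0≤q = begin
    p           ≡⟨ ℚ.+-identityʳ p ⟨
    p + 0ℚ      ≤⟨ ℚ.+-monoʳ-≤ p 0≤q ⟩
    p + q       ∎

  archimedean : ∀ ε → 0ℚ < ε → ∃ λ N → 1ℚ ≤ ε * ι N
  archimedean ε 0<ε = N , (begin
    1ℚ                 ≡⟨ *-inv ε 0<ε ⟨
    ε * inv ε 0<ε      ≤⟨ *-monoˡ ε (ℚ.<⇒≤ 0<ε) (ℚ.≤-trans (p≤⌈p⌉ (inv ε 0<ε)) (⟨⟩-mono (i≤∣i∣ (ℚ.ceiling (inv ε 0<ε))))) ⟩
    ε * ι N            ∎)
    where
    N = ℤ.∣ ℚ.ceiling (inv ε 0<ε) ∣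
    i≤∣i∣ : ∀ i → i ℤ.≤ + ℤ.∣ i ∣
    i≤∣i∣ (+ n)      = ℤ.≤-refl
    i≤∣i∣ ℤ.-[1+ n ] = ℤ.-≤+

  ≡⇒∣p-q∣≤ : ∀ {p q ε} → p ≡ q → 0ℚ < ε → ∣ p - q ∣ ≤ ε
  ≡⇒∣p-q∣≤ {p} {ε = ε} refl 0<ε = subst (_≤ ε) (cong ∣_∣ (sym (ℚ.+-inverseʳ p))) (ℚ.<⇒≤ 0<ε)

  ≃-refl : ∀ {x} → x ≃ x
  ≃-refl {x} ε 0<ε = 0 , λ n _ → ≡⇒∣p-q∣≤ {seq x n} refl 0<ε

  ≃-sym : ∀ {x y} → x ≃ y → y ≃ x
  ≃-sym {x} {y} x≃y ε 0<ε = let N , h = x≃y ε 0<ε in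
    N , λ n N≤n → subst (_≤ ε) (∣p-q∣≡∣q-p∣ (seq x n) (seq y n)) (h n N≤n)

  ≃-trans : ∀ {x y z} → x ≃ y → y ≃ z → x ≃ z
  ≃-trans {x} {y} {z} x≃y y≃z ε 0<ε =
    let N , h = x≃y (ε * ½) (0<p*q 0<ε ½>0)
        N′ , h′ = y≃z (ε * ½) (0<p*q 0<ε ½>0)
    in N ℕ.⊔ N′ , λ n ≤n → begin
      ∣ seq x n - seq z n ∣                            ≤⟨ ∣p-q∣≤∣p-r∣+∣r-q∣ (seq x n) (seq y n) (seq z n) ⟩
      ∣ seq x n - seq y n ∣ + ∣ seq y n - seq z n ∣    ≤⟨ ℚ.+-mono-≤ (h n (ℕ.m⊔n≤o⇒m≤o N N′ ≤n)) (h′ n (ℕ.m⊔n≤o⇒n≤o N N′ ≤n)) ⟩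
      ε * ½ + ε * ½                                    ≡⟨ halves ε ⟩
      ε                                                ∎

  0≤‖_‖ : ∀ r → 0ℚ ≤ Rational.‖ r ‖
  0≤‖ r ‖ = let k , eq = ‖p‖-attained r in subst (0ℚ ≤_) (sym eq) (ℚ.0≤∣p∣ (r - ⟨ k ⟩))

  -- The distance to the nearest integer is 1-Lipschitz, so replacing x by y costs at most C Q ∣x -
  -- y∣. The factor `c` is kept apart from its bound `C` because it may vary with the index of a
  -- real's terms, while the accuracy demanded of x and y has to be fixed in advance.
  perturb : ∀ c C Q x y ε (0<CQ : 0ℚ < C * Q) → 0ℚ ≤ Q → 0ℚ ≤ c → c ≤ C →
            ∣ x - y ∣ ≤ ε * inv (C * Q) 0<CQ →
            c * Rational.‖ Q * y ‖ ≤ c * Rational.‖ Q * x ‖ + ε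
  perturb c C Q x y ε 0<CQ 0≤Q 0≤c c≤C near = begin
    c * Rational.‖ Q * y ‖
      ≤⟨ *-monoˡ c 0≤c (p-q≤r⇒p≤q+r Rational.‖ Q * y ‖ Rational.‖ Q * x ‖ e
          (ℚ.≤-trans (p≤∣p∣ _) (‖‖-lipschitz (Q * y) (Q * x)))) ⟩
    c * (Rational.‖ Q * x ‖ + e)
      ≡⟨ ℚ.*-distribˡ-+ c Rational.‖ Q * x ‖ e ⟩
    c * Rational.‖ Q * x ‖ + c * e
      ≤⟨ ℚ.+-monoʳ-≤ (c * Rational.‖ Q * x ‖) (*-monoʳ e (ℚ.0≤∣p∣ (Q * y - Q * x)) c≤C) ⟩
    c * Rational.‖ Q * x ‖ + C * e
      ≡⟨ cong (λ u → c * Rational.‖ Q * x ‖ + u) scaled ⟩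
    c * Rational.‖ Q * x ‖ + C * Q * ∣ x - y ∣
      ≤⟨ ℚ.+-monoʳ-≤ (c * Rational.‖ Q * x ‖) (*-monoˡ (C * Q) (ℚ.<⇒≤ 0<CQ) near) ⟩
    c * Rational.‖ Q * x ‖ + C * Q * (ε * inv (C * Q) 0<CQ)
      ≡⟨ cong (λ u → c * Rational.‖ Q * x ‖ + u) (*-inv-cancel (C * Q) 0<CQ ε) ⟩
    c * Rational.‖ Q * x ‖ + ε ∎
    where
    e : ℚ
    e = ∣ Q * y - Q * x ∣
    scaled : C * e ≡ C * Q * ∣ x - y ∣
    scaled = begin-equality
      C * e                     ≡⟨ cong (λ u → C * ∣ u ∣) (solve 3 (λ Q x y → Q :* y :- Q :* x := Q :* (y :- x)) refl Q x y) ⟩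
      C * ∣ Q * (y - x) ∣       ≡⟨ cong (C *_) (∣p*q∣≡p*∣q∣ (y - x) 0≤Q) ⟩
      C * (Q * ∣ y - x ∣)       ≡⟨ ℚ.*-assoc C Q ∣ y - x ∣ ⟨
      C * Q * ∣ y - x ∣         ≡⟨ cong (λ u → C * Q * u) (∣p-q∣≡∣q-p∣ y x) ⟩
      C * Q * ∣ x - y ∣         ∎

  Bad-respects-≃ : Bad Respects _≃_
  Bad-respects-≃ {x} {y} x≃y (c , 0<c , c≤) = c , 0<c , λ n ε 0<ε →
    let 0<n = ⟨⟩-pos (ℕ.>-nonZero⁻¹ n)
        0<nn = 0<p*q 0<n 0<n
        0<ε/2 = 0<p*q 0<ε ½>0
        N , f = c≤ n (ε * ½) 0<ε/2
        N′ , g = x≃y (ε * ½ * inv (ι n * ι n) 0<nn) (0<p*q 0<ε/2 (inv-pos (ι n * ι n) 0<nn))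
    in N ℕ.⊔ N′ , λ m ≤m → begin
      seq c m
        ≤⟨ f m (ℕ.m⊔n≤o⇒m≤o N N′ ≤m) ⟩
      ι n * Rational.‖ ι n * seq x m ‖ + ε * ½
        ≤⟨ ℚ.+-monoˡ-≤ (ε * ½) (perturb (ι n) (ι n) (ι n) (seq y m) (seq x m) (ε * ½) 0<nn (0≤ι n) (0≤ι n) ℚ.≤-refl
            (subst (_≤ ε * ½ * inv (ι n * ι n) 0<nn) (∣p-q∣≡∣q-p∣ (seq x m) (seq y m)) (g m (ℕ.m⊔n≤o⇒n≤o N N′ ≤m)))) ⟩
      ι n * Rational.‖ ι n * seq y m ‖ + ε * ½ + ε * ½
        ≡⟨ ℚ.+-assoc (ι n * Rational.‖ ι n * seq y m ‖) (ε * ½) (ε * ½) ⟩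
      ι n * Rational.‖ ι n * seq y m ‖ + (ε * ½ + ε * ½)
        ≡⟨ cong (λ u → ι n * Rational.‖ ι n * seq y m ‖ + u) (halves ε) ⟩
      ι n * Rational.‖ ι n * seq y m ‖ + ε ∎

-- Continuants: convergents, bad approximability, the mirror formula, separation.

module Continuants where
  open import Data.Rational using (_+_; _-_; _*_; -_; _≤_; _<_; ∣_∣)
  open Rational hiding (‖_‖)
  open ℚ.≤-Reasoning
  open +-*-Solver using (solve; _:=_; _:+_; _:*_; _:-_; :-_; con)
  open Arithmetic

  -- A word d₁ ∷ … ∷ dₙ ∷ [] stands for [0; dₙ, …, d₁], the last digit first, so
  -- that consing a digit passes from one convergent to the next; the superscript ⁻
  -- marks the numerator and denominator of the convergent before the last.
  cont⁻ cont : ℕ → ℕ → List ℕ → ℕ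
  cont⁻ a b []      = a
  cont⁻ a b (d ∷ w) = cont a b w
  cont  a b []      = b
  cont  a b (d ∷ w) = cont⁻ a b w ℕ.+ d ℕ.* cont a b w

  num⁻ num den⁻ den : List ℕ → ℕ
  num⁻ = cont⁻ 1 0
  num  = cont 1 0
  den⁻ = cont⁻ 0 1
  den  = cont 0 1

  -- The recurrence is linear in its starting pair: starting from (1, 0) it gives the numerators,
  -- from (0, 1) the denominators. A word thus acts as a 2 × 2 matrix, and concatenation multiplies
  -- matrices.
  cont⁻-++ : ∀ a b x w → cont⁻ a b (x ++ w) ≡ cont⁻ a b w ℕ.* num⁻ x ℕ.+ cont a b w ℕ.* den⁻ x
  cont-++  : ∀ a b x w → cont a b (x ++ w) ≡ cont⁻ a b w ℕ.* num x ℕ.+ cont a b w ℕ.* den x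
  cont⁻-++ a b [] w      = lemma (cont⁻ a b w) (cont a b w)
    where
    lemma : ∀ m n → m ≡ m ℕ.* 1 ℕ.+ n ℕ.* 0
    lemma = ℕ.solve-∀
  cont⁻-++ a b (d ∷ x) w = cont-++ a b x w
  cont-++ a b [] w       = lemma (cont⁻ a b w) (cont a b w)
    where
    lemma : ∀ m n → n ≡ m ℕ.* 0 ℕ.+ n ℕ.* 1
    lemma = ℕ.solve-∀
  cont-++ a b (d ∷ x) w  = trans
    (cong₂ (λ m n → m ℕ.+ d ℕ.* n) (cont⁻-++ a b x w) (cont-++ a b x w))
    (lemma (cont⁻ a b w) (cont a b w) d (num⁻ x) (num x) (den⁻ x) (den x))
    where
    lemma : ∀ m n d p⁻ p q⁻ q → m ℕ.* p⁻ ℕ.+ n ℕ.* q⁻ ℕ.+ d ℕ.* (m ℕ.* p ℕ.+ n ℕ.* q)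
                              ≡ m ℕ.* (p⁻ ℕ.+ d ℕ.* p) ℕ.+ n ℕ.* (q⁻ ℕ.+ d ℕ.* q)
    lemma = ℕ.solve-∀

  p⁻ p q⁻ q : List ℕ → ℚ
  p⁻ w = ι (num⁻ w)
  p  w = ι (num w)
  q⁻ w = ι (den⁻ w)
  q  w = ι (den w)

  ι-cont : ∀ a b d w → ι (cont a b (d ∷ w)) ≡ ι (cont⁻ a b w) + ι d * ι (cont a b w)
  ι-cont a b d w = trans (ι-+ (cont⁻ a b w) (d ℕ.* cont a b w))
    (cong (λ z → ι (cont⁻ a b w) + z) (ι-* d (cont a b w)))

  ι-cont⁻-++ : ∀ a b x w → ι (cont⁻ a b (x ++ w)) ≡ ι (cont⁻ a b w) * p⁻ x + ι (cont a b w) * q⁻ x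
  ι-cont⁻-++ a b x w = trans (cong ι (cont⁻-++ a b x w))
    (trans (ι-+ (cont⁻ a b w ℕ.* num⁻ x) (cont a b w ℕ.* den⁻ x))
      (cong₂ _+_ (ι-* (cont⁻ a b w) (num⁻ x)) (ι-* (cont a b w) (den⁻ x))))

  ι-cont-++ : ∀ a b x w → ι (cont a b (x ++ w)) ≡ ι (cont⁻ a b w) * p x + ι (cont a b w) * q x
  ι-cont-++ a b x w = trans (cong ι (cont-++ a b x w))
    (trans (ι-+ (cont⁻ a b w ℕ.* num x) (cont a b w ℕ.* den x))
      (cong₂ _+_ (ι-* (cont⁻ a b w) (num x)) (ι-* (cont a b w) (den x))))

  -- Each digit contributes a matrix of determinant -1; the absolute value spares tracking the
  -- parity of the length.
  det : ∀ w → ∣ p⁻ w * q w - p w * q⁻ w ∣ ≡ 1ℚ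
  det []      = refl
  det (d ∷ w) = begin-equality
    ∣ p w * q (d ∷ w) - p (d ∷ w) * q w ∣
      ≡⟨ cong₂ (λ y z → ∣ p w * y - z * q w ∣) (ι-cont 0 1 d w) (ι-cont 1 0 d w) ⟩
    ∣ p w * (q⁻ w + ι d * q w) - (p⁻ w + ι d * p w) * q w ∣
      ≡⟨ cong ∣_∣ (solve 5 (λ a b c e d → b :* (c :+ d :* e) :- (a :+ d :* b) :* e := :- (a :* e :- b :* c)) refl
          (p⁻ w) (p w) (q⁻ w) (q w) (ι d)) ⟩
    ∣ - (p⁻ w * q w - p w * q⁻ w) ∣
      ≡⟨ ℚ.∣-p∣≡∣p∣ (p⁻ w * q w - p w * q⁻ w) ⟩
    ∣ p⁻ w * q w - p w * q⁻ w ∣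
      ≡⟨ det w ⟩
    1ℚ ∎

  Digit : ℕ → ℕ → Set
  Digit K d = 1 ℕ.≤ d × d ℕ.≤ K

  Word : ℕ → List ℕ → Set
  Word K = All (Digit K)

  module _ {K : ℕ} where

    1≤den : ∀ {w} → Word K w → 1 ℕ.≤ den w
    1≤den []                      = ℕ.≤-refl
    1≤den {d ∷ w} ((1≤d , _) ∷ h) = ℕ.≤-trans (ℕ.*-mono-≤ 1≤d (1≤den h)) (ℕ.m≤n+m _ (den⁻ w))

    den≤den-∷ : ∀ {d w} → Word K (d ∷ w) → den w ℕ.≤ den (d ∷ w)
    den≤den-∷ {d} {w} ((1≤d , _) ∷ h) = ℕ.≤-trans
      (ℕ.≤-reflexive (sym (ℕ.*-identityˡ (den w))))
      (ℕ.≤-trans (ℕ.*-monoˡ-≤ (den w) 1≤d) (ℕ.m≤n+m _ (den⁻ w)))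

    den⁻≤den : ∀ {w} → Word K w → den⁻ w ℕ.≤ den w
    den⁻≤den []          = ℕ.z≤n
    den⁻≤den h@(_ ∷ _)   = den≤den-∷ h

    num≤den : ∀ {w} → Word K w → num w ℕ.≤ den w
    num≤den []                               = ℕ.z≤n
    num≤den {d ∷ []} ((1≤d , _) ∷ [])        = subst₂ ℕ._≤_ (cong suc (sym (ℕ.*-zeroʳ d))) (sym (ℕ.*-identityʳ d)) 1≤d
    num≤den {d ∷ e ∷ w} (_ ∷ h@(_ ∷ h′))     = ℕ.+-mono-≤ (num≤den h′) (ℕ.*-monoʳ-≤ d (num≤den h))

    -- From the second digit on, each digit adds at least the denominator before the last, which is
    -- at least 1. This turns lengths into lower bounds for denominators, both for convergence and
    -- for reaching the threshold of φ.
    length≤den : ∀ {w} → Word K w → length w ℕ.≤ den w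
    length≤den []                                       = ℕ.z≤n
    length≤den {d ∷ []} ((1≤d , _) ∷ [])                = subst (1 ℕ.≤_) (sym (ℕ.*-identityʳ d)) 1≤d
    length≤den {d ∷ e ∷ w} ((1≤d , _) ∷ h@(_ ∷ h′))     = ℕ.+-mono-≤ (1≤den h′)
      (ℕ.≤-trans (length≤den h) (ℕ.≤-trans (ℕ.≤-reflexive (sym (ℕ.*-identityˡ (den (e ∷ w))))) (ℕ.*-monoˡ-≤ (den (e ∷ w)) 1≤d)))

    den-∷≤ : ∀ {d w} → Word K (d ∷ w) → den (d ∷ w) ℕ.≤ suc K ℕ.* den w
    den-∷≤ {w = w} ((_ , d≤K) ∷ h) = ℕ.+-mono-≤ (den⁻≤den h) (ℕ.*-monoˡ-≤ (den w) d≤K)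

    q-pos : ∀ {w} → Word K w → 0ℚ < q w
    q-pos h = ⟨⟩-pos (1≤den h)

    1≤q : ∀ {w} → Word K w → 1ℚ ≤ q w
    1≤q h = ι-mono (1≤den h)

    value : ∀ {w} → Word K w → ℚ
    value {w} h = p w * inv (q w) (q-pos h)

    q*value : ∀ {w} (h : Word K w) → q w * value h ≡ p w
    q*value {w} h = *-inv-cancel (q w) (q-pos h) (p w)

    ∣c*value-e∣*q : ∀ {w} (h : Word K w) c e → ∣ c * value h - e ∣ * q w ≡ ∣ c * p w - e * q w ∣
    ∣c*value-e∣*q {w} h c e = begin-equality
      ∣ c * value h - e ∣ * q w            ≡⟨ ℚ.*-comm _ (q w) ⟩
      q w * ∣ c * value h - e ∣            ≡⟨ ∣p*q∣≡p*∣q∣ (c * value h - e) (0≤ι (den w)) ⟨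
      ∣ q w * (c * value h - e) ∣          ≡⟨ cong ∣_∣ (solve 4 (λ q c v e → q :* (c :* v :- e) := c :* (q :* v) :- e :* q) refl (q w) c (value h) e) ⟩
      ∣ c * (q w * value h) - e * q w ∣    ≡⟨ cong (λ z → ∣ c * z - e * q w ∣) (q*value h) ⟩
      ∣ c * p w - e * q w ∣                ∎

    q*q≤q-++ : ∀ x w → q w * q x ≤ q (x ++ w)
    q*q≤q-++ x w = begin
      q w * q x                     ≤⟨ p≤p+q (0≤p*q (0≤ι (den⁻ w)) (0≤ι (num x))) ⟩
      q w * q x + q⁻ w * p x        ≡⟨ ℚ.+-comm (q w * q x) (q⁻ w * p x) ⟩
      q⁻ w * p x + q w * q x        ≡⟨ ι-cont-++ 0 1 x w ⟨
      q (x ++ w)                    ∎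

    -- The later digits `x` enter the error of a convergent only through the factor `q x`, which
    -- `q*q≤q-++` cancels; the bound that remains is uniform in `x`.
    scale : ∀ {x w} c → Word K x → 0ℚ ≤ c → c * q (x ++ w) ≤ q x → c * q w ≤ 1ℚ
    scale {x} {w} c hx 0≤c h = *-cancelˡ (q x) (q-pos hx) (begin
      q x * (c * q w)      ≡⟨ solve 3 (λ x c w → x :* (c :* w) := c :* (w :* x)) refl (q x) c (q w) ⟩
      c * (q w * q x)      ≤⟨ *-monoˡ c 0≤c (q*q≤q-++ x w) ⟩
      c * q (x ++ w)       ≤⟨ h ⟩
      q x                  ≡⟨ ℚ.*-identityʳ (q x) ⟨
      q x * 1ℚ             ∎)

    -- Expanding over `x ++ w` leaves `p x` times the determinant of `w`, and `p x` is at most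
    -- `q x`.
    convergent : ∀ {x w} (hx : Word K x) (h : Word K (x ++ w)) → ∣ q w * value h - p w ∣ * q w ≤ 1ℚ
    convergent {x} {w} hx h = scale {x} {w} ∣ q w * value h - p w ∣ hx (ℚ.0≤∣p∣ (q w * value h - p w)) (begin
      ∣ q w * value h - p w ∣ * q (x ++ w)
        ≡⟨ ∣c*value-e∣*q h (q w) (p w) ⟩
      ∣ q w * p (x ++ w) - p w * q (x ++ w) ∣
        ≡⟨ cong₂ (λ y z → ∣ q w * y - p w * z ∣) (ι-cont-++ 1 0 x w) (ι-cont-++ 0 1 x w) ⟩
      ∣ q w * (p⁻ w * p x + p w * q x) - p w * (q⁻ w * p x + q w * q x) ∣
        ≡⟨ cong ∣_∣ (solve 6 (λ a b c d e f → d :* (a :* e :+ b :* f) :- b :* (c :* e :+ d :* f) := e :* (a :* d :- b :* c)) refl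
            (p⁻ w) (p w) (q⁻ w) (q w) (p x) (q x)) ⟩
      ∣ p x * (p⁻ w * q w - p w * q⁻ w) ∣
        ≡⟨ ∣p*q∣≡p*∣q∣ _ (0≤ι (num x)) ⟩
      p x * ∣ p⁻ w * q w - p w * q⁻ w ∣
        ≡⟨ cong (p x *_) (det w) ⟩
      p x * 1ℚ
        ≡⟨ ℚ.*-identityʳ (p x) ⟩
      p x
        ≤⟨ ι-mono (num≤den hx) ⟩
      q x ∎)

    convergent⁻ : ∀ {x w} (hx : Word K x) (h : Word K (x ++ w)) → ∣ q⁻ w * value h - p⁻ w ∣ * q w ≤ 1ℚ
    convergent⁻ {x} {w} hx h = scale {x} {w} ∣ q⁻ w * value h - p⁻ w ∣ hx (ℚ.0≤∣p∣ (q⁻ w * value h - p⁻ w)) (ℚ.≤-reflexive (begin-equality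
      ∣ q⁻ w * value h - p⁻ w ∣ * q (x ++ w)
        ≡⟨ ∣c*value-e∣*q h (q⁻ w) (p⁻ w) ⟩
      ∣ q⁻ w * p (x ++ w) - p⁻ w * q (x ++ w) ∣
        ≡⟨ cong₂ (λ y z → ∣ q⁻ w * y - p⁻ w * z ∣) (ι-cont-++ 1 0 x w) (ι-cont-++ 0 1 x w) ⟩
      ∣ q⁻ w * (p⁻ w * p x + p w * q x) - p⁻ w * (q⁻ w * p x + q w * q x) ∣
        ≡⟨ cong ∣_∣ (solve 6 (λ a b c d e f → c :* (a :* e :+ b :* f) :- a :* (c :* e :+ d :* f) := :- (f :* (a :* d :- b :* c))) refl
            (p⁻ w) (p w) (q⁻ w) (q w) (p x) (q x)) ⟩
      ∣ - (q x * (p⁻ w * q w - p w * q⁻ w)) ∣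
        ≡⟨ ℚ.∣-p∣≡∣p∣ (q x * (p⁻ w * q w - p w * q⁻ w)) ⟩
      ∣ q x * (p⁻ w * q w - p w * q⁻ w) ∣
        ≡⟨ ∣p*q∣≡p*∣q∣ _ (0≤ι (den x)) ⟩
      q x * ∣ p⁻ w * q w - p w * q⁻ w ∣
        ≡⟨ cong (q x *_) (det w) ⟩
      q x * 1ℚ
        ≡⟨ ℚ.*-identityʳ (q x) ⟩
      q x ∎))

  2ℚ 4ℚ : ℚ
  2ℚ = ι 2
  4ℚ = ι 4

  module _ {K : ℕ} where

    -- The nonzero integer n e - k c equals c (n β - k) - n (c β - e). The second term is at most
    -- 1/2 in absolute value, so c ∣n β - k∣ is at least 1/2, and the bound on c turns this into one
    -- in terms of n. The factor 4 is this 2 times the 2 in 2n.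
    away : ∀ (c e n : ℕ) k (C β : ℚ) → k ℤ.* + c ≢ + n ℤ.* + e →
           ∣ ι c * β - ι e ∣ * (2ℚ * ι n) ≤ 1ℚ → ι c ≤ C * (2ℚ * ι n) →
           1ℚ ≤ C * (4ℚ * (ι n * ∣ ι n * β - ⟨ k ⟩ ∣))
    away c e n k C β kc≢ne close small = begin
      1ℚ                                  ≡⟨ solve 0 (con 1ℚ := con 2ℚ :- con 1ℚ) refl ⟩
      2ℚ - 1ℚ                             ≤⟨ p≤q+r⇒p-q≤r 2ℚ 1ℚ _ 2≤ ⟩
      2ℚ * (ι c * y)                      ≤⟨ *-monoˡ 2ℚ (0≤ι 2) (*-monoʳ y (ℚ.0≤∣p∣ _) small) ⟩
      2ℚ * (C * (2ℚ * ι n) * y)           ≡⟨ solve 3 (λ C n y → con 2ℚ :* (C :* (con 2ℚ :* n) :* y) := C :* (con 4ℚ :* (n :* y))) refl C (ι n) y ⟩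
      C * (4ℚ * (ι n * y))                ∎
      where
      x y : ℚ
      x = ∣ ι c * β - ι e ∣
      y = ∣ ι n * β - ⟨ k ⟩ ∣
      kc-ne≢0 : + n ℤ.* + e ℤ.- k ℤ.* + c ≢ + 0
      kc-ne≢0 eq = kc≢ne (sym (ℤ.i-j≡0⇒i≡j (+ n ℤ.* + e) (k ℤ.* + c) eq))
      homo : ⟨ + n ℤ.* + e ℤ.- k ℤ.* + c ⟩ ≡ ι n * ι e - ⟨ k ⟩ * ι c
      homo = trans (⟨⟩-minus (+ n ℤ.* + e) (k ℤ.* + c)) (cong₂ _-_ (⟨⟩-* (+ n) (+ e)) (⟨⟩-* k (+ c)))
      1≤ : 1ℚ ≤ ι c * y + ι n * x
      1≤ = begin
        1ℚ
          ≤⟨ 1≤∣⟨⟩∣ _ kc-ne≢0 ⟩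
        ∣ ⟨ + n ℤ.* + e ℤ.- k ℤ.* + c ⟩ ∣
          ≡⟨ cong ∣_∣ homo ⟩
        ∣ ι n * ι e - ⟨ k ⟩ * ι c ∣
          ≡⟨ cong ∣_∣ (solve 5 (λ n e k c β → n :* e :- k :* c := c :* (n :* β :- k) :- n :* (c :* β :- e)) refl (ι n) (ι e) ⟨ k ⟩ (ι c) β) ⟩
        ∣ ι c * (ι n * β - ⟨ k ⟩) - ι n * (ι c * β - ι e) ∣
          ≤⟨ ℚ.∣p-q∣≤∣p∣+∣q∣ (ι c * (ι n * β - ⟨ k ⟩)) (ι n * (ι c * β - ι e)) ⟩
        ∣ ι c * (ι n * β - ⟨ k ⟩) ∣ + ∣ ι n * (ι c * β - ι e) ∣
          ≡⟨ cong₂ _+_ (∣p*q∣≡p*∣q∣ _ (0≤ι c)) (∣p*q∣≡p*∣q∣ _ (0≤ι n)) ⟩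
        ι c * y + ι n * x ∎
      2≤ : 2ℚ ≤ 1ℚ + 2ℚ * (ι c * y)
      2≤ = begin
        2ℚ * 1ℚ                               ≤⟨ *-monoˡ 2ℚ (0≤ι 2) 1≤ ⟩
        2ℚ * (ι c * y + ι n * x)              ≡⟨ solve 4 (λ c y n x → con 2ℚ :* (c :* y :+ n :* x) := x :* (con 2ℚ :* n) :+ con 2ℚ :* (c :* y)) refl (ι c) y (ι n) x ⟩
        x * (2ℚ * ι n) + 2ℚ * (ι c * y)       ≤⟨ ℚ.+-monoˡ-≤ _ close ⟩
        1ℚ + 2ℚ * (ι c * y)                   ∎

    -- If k/n were equal to both convergents, n times the determinant would vanish.
    adjacent : ∀ w n k → 0 ℕ.< n → k ℤ.* + den w ≡ + n ℤ.* + num w → k ℤ.* + den⁻ w ≢ + n ℤ.* + num⁻ w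
    adjacent w n k 0<n eq eq⁻ = ℚ.<⇒≢ (⟨⟩-pos 0<n) (sym (begin-equality
      ι n                                        ≡⟨ ℚ.*-identityʳ (ι n) ⟨
      ι n * 1ℚ                                   ≡⟨ cong (λ z → ι n * z) (det w) ⟨
      ι n * ∣ p⁻ w * q w - p w * q⁻ w ∣          ≡⟨ ∣p*q∣≡p*∣q∣ _ (0≤ι n) ⟨
      ∣ ι n * (p⁻ w * q w - p w * q⁻ w) ∣        ≡⟨ cong ∣_∣ (solve 5 (λ n a b c d → n :* (a :* d :- b :* c) := n :* a :* d :- n :* b :* c) refl (ι n) (p⁻ w) (p w) (q⁻ w) (q w)) ⟩
      ∣ ι n * p⁻ w * q w - ι n * p w * q⁻ w ∣    ≡⟨ cong₂ (λ y z → ∣ y * q w - z * q⁻ w ∣) (homo (den⁻ w) (num⁻ w) eq⁻) (homo (den w) (num w) eq) ⟨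
      ∣ ⟨ k ⟩ * q⁻ w * q w - ⟨ k ⟩ * q w * q⁻ w ∣  ≡⟨ cong ∣_∣ (solve 3 (λ k c d → k :* c :* d :- k :* d :* c := con 0ℚ) refl ⟨ k ⟩ (q⁻ w) (q w)) ⟩
      0ℚ                                         ∎))
      where
      homo : ∀ c e → k ℤ.* + c ≡ + n ℤ.* + e → ⟨ k ⟩ * ι c ≡ ι n * ι e
      homo c e eq = trans (sym (⟨⟩-* k (+ c))) (trans (cong ⟨_⟩ eq) (⟨⟩-* (+ n) (+ e)))

    -- Compare k/n with the last convergent of denominator below 2n, or with the
    -- next one if the former equals k/n.
    badly-step : ∀ {x} d w (h : Word K (x ++ d ∷ w)) n k → 0 ℕ.< n → den w ℕ.≤ 2 ℕ.* n → 2 ℕ.* n ℕ.≤ den (d ∷ w) →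
                 1ℚ ≤ ι (suc K) * (4ℚ * (ι n * ∣ ι n * value h - ⟨ k ⟩ ∣))
    badly-step {x} d w h n k 0<n ≤2n 2n≤ = compare (k ℤ.* + den w ℤ.≟ + n ℤ.* + num w)
      where
      homo : ι (suc K ℕ.* (2 ℕ.* n)) ≡ ι (suc K) * (2ℚ * ι n)
      homo = trans (ι-* (suc K) (2 ℕ.* n)) (cong (λ z → ι (suc K) * z) (ι-* 2 n))
      close : ∀ c e → ∣ c * value h - e ∣ * q (d ∷ w) ≤ 1ℚ → ∣ c * value h - e ∣ * (2ℚ * ι n) ≤ 1ℚ
      close c e = ℚ.≤-trans (*-monoˡ _ (ℚ.0≤∣p∣ (c * value h - e)) (subst (_≤ q (d ∷ w)) (ι-* 2 n) (ι-mono 2n≤)))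
      compare : Dec (k ℤ.* + den w ≡ + n ℤ.* + num w) → 1ℚ ≤ ι (suc K) * (4ℚ * (ι n * ∣ ι n * value h - ⟨ k ⟩ ∣))
      -- The error of p w / q w must be measured against the next denominator, which is at least 2n;
      -- hence `convergent⁻` at `d ∷ w` and not `convergent` at `w`.
      compare (no k/n≢)  = away (den w) (num w) n k (ι (suc K)) (value h) k/n≢
        (close (q w) (p w) (convergent⁻ {x = x} {d ∷ w} (++⁻ˡ x h) h))
        (begin
          q w                         ≤⟨ ι-mono ≤2n ⟩
          ι (2 ℕ.* n)                 ≤⟨ ι-mono (ℕ.m≤n*m (2 ℕ.* n) (suc K)) ⟩
          ι (suc K ℕ.* (2 ℕ.* n))     ≡⟨ homo ⟩
          ι (suc K) * (2ℚ * ι n)      ∎)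
      compare (yes k/n≡) = away (den (d ∷ w)) (num (d ∷ w)) n k (ι (suc K)) (value h)
        (λ eq → adjacent (d ∷ w) n k 0<n eq k/n≡)
        (close (q (d ∷ w)) (p (d ∷ w)) (convergent {x = x} {d ∷ w} (++⁻ˡ x h) h))
        (begin
          q (d ∷ w)                   ≤⟨ ι-mono (den-∷≤ (++⁻ʳ x h)) ⟩
          ι (suc K ℕ.* den w)         ≤⟨ ι-mono (ℕ.*-monoʳ-≤ (suc K) ≤2n) ⟩
          ι (suc K ℕ.* (2 ℕ.* n))     ≡⟨ homo ⟩
          ι (suc K) * (2ℚ * ι n)      ∎)

    -- Digits are stripped off `w` until 2n lies between two successive denominators. A stripped
    -- digit joins `x`, so the whole word and its value do not change.
    badly : ∀ {x} w (h : Word K (x ++ w)) n k → 0 ℕ.< n → 2 ℕ.* n ℕ.≤ den w →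
            1ℚ ≤ ι (suc K) * (4ℚ * (ι n * ∣ ι n * value h - ⟨ k ⟩ ∣))
    badly [] h n k 0<n 2n≤1 = contradiction 2n≤1 (ℕ.<⇒≱ (ℕ.*-monoʳ-≤ 2 0<n))
    badly {x} (d ∷ w) h n k 0<n 2n≤ with 2 ℕ.* n ℕ.≤? den w
    ... | no 2n≰    = badly-step {x} d w h n k 0<n (ℕ.<⇒≤ (ℕ.≰⇒> 2n≰)) 2n≤
    ... | yes 2n≤′  = regroup (++-assoc x (d ∷ []) w) h
      where
      regroup : ∀ {v} → (x ++ d ∷ []) ++ w ≡ v → (h : Word K v) →
                1ℚ ≤ ι (suc K) * (4ℚ * (ι n * ∣ ι n * value h - ⟨ k ⟩ ∣))
      regroup refl h = badly {x ++ d ∷ []} w h n k 0<n 2n≤′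

    -- Reading a word backwards transposes its matrix, so den⁻ (x ++ w) / den (x ++ w)
    -- is a number whose continued fraction expansion starts with the digits of x.
    mirror : ∀ {x w} → Word K x → Word K w → ∀ z t → 0ℚ ≤ t → t ≤ 1ℚ →
             z * (q x + p x * t) ≡ q⁻ x + p⁻ x * t →
             q (x ++ w) * ∣ z * q (x ++ w) - q⁻ (x ++ w) ∣ ≤ 2ℚ * (q w * q w)
    mirror {x} {w} hx hw z t 0≤t t≤1 eq = begin
      q (x ++ w) * e                    ≤⟨ *-monoʳ e (ℚ.0≤∣p∣ _) upper ⟩
      2ℚ * (q w * q x) * e              ≡⟨ solve 3 (λ a b e → con 2ℚ :* (a :* b) :* e := con 2ℚ :* (a :* (b :* e))) refl (q w) (q x) e ⟩
      2ℚ * (q w * (q x * e))            ≤⟨ *-monoˡ 2ℚ (0≤ι 2) (*-monoˡ (q w) (0≤ι (den w)) close) ⟩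
      2ℚ * (q w * q w)                  ∎
      where
      e v : ℚ
      e = ∣ z * q (x ++ w) - q⁻ (x ++ w) ∣
      v = q x + p x * t
      0≤pt : 0ℚ ≤ p x * t
      0≤pt = 0≤p*q (0≤ι (num x)) 0≤t
      ct≤c : q w * t ≤ q w
      ct≤c = ℚ.≤-trans (*-monoˡ (q w) (0≤ι (den w)) t≤1) (ℚ.≤-reflexive (ℚ.*-identityʳ (q w)))
      upper : q (x ++ w) ≤ 2ℚ * (q w * q x)
      upper = begin
        q (x ++ w)                      ≡⟨ ι-cont-++ 0 1 x w ⟩
        q⁻ w * p x + q w * q x          ≤⟨ ℚ.+-monoˡ-≤ (q w * q x) (*-mono-≤ (0≤ι (den⁻ w)) (0≤ι (den x)) (ι-mono (den⁻≤den hw)) (ι-mono (num≤den hx))) ⟩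
        q w * q x + q w * q x           ≡⟨ solve 1 (λ a → a :+ a := con 2ℚ :* a) refl (q w * q x) ⟩
        2ℚ * (q w * q x)                ∎
      -- `z` is a Möbius map, given by `x`, evaluated at `t`; the ratio of denominators of `x ++ w`
      -- is the same map evaluated at q⁻ w / q w. Their difference is the determinant times the
      -- difference of the arguments, up to the denominators.
      identity : v * (z * q (x ++ w) - q⁻ (x ++ w)) ≡ (p⁻ x * q x - p x * q⁻ x) * (q w * t - q⁻ w)
      identity = begin-equality
        v * (z * q (x ++ w) - q⁻ (x ++ w))
          ≡⟨ solve 4 (λ v z a b → v :* (z :* a :- b) := z :* v :* a :- v :* b) refl v z (q (x ++ w)) (q⁻ (x ++ w)) ⟩
        z * v * q (x ++ w) - v * q⁻ (x ++ w)
          ≡⟨ cong₂ (λ a b → z * v * a - v * b) (ι-cont-++ 0 1 x w) (ι-cont⁻-++ 0 1 x w) ⟩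
        z * v * (q⁻ w * p x + q w * q x) - v * (q⁻ w * p⁻ x + q w * q⁻ x)
          ≡⟨ cong (λ a → a * (q⁻ w * p x + q w * q x) - v * (q⁻ w * p⁻ x + q w * q⁻ x)) eq ⟩
        (q⁻ x + p⁻ x * t) * (q⁻ w * p x + q w * q x) - v * (q⁻ w * p⁻ x + q w * q⁻ x)
          ≡⟨ solve 7 (λ a b c d e f t → (c :+ a :* t) :* (e :* b :+ f :* d) :- (d :+ b :* t) :* (e :* a :+ f :* c)
                := (a :* d :- b :* c) :* (f :* t :- e)) refl (p⁻ x) (p x) (q⁻ x) (q x) (q⁻ w) (q w) t ⟩
        (p⁻ x * q x - p x * q⁻ x) * (q w * t - q⁻ w) ∎
      close : q x * e ≤ q w
      close = begin
        q x * e                                                ≤⟨ *-monoʳ e (ℚ.0≤∣p∣ _) (p≤p+q {q x} 0≤pt) ⟩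
        v * e                                                  ≡⟨ ∣p*q∣≡p*∣q∣ _ (ℚ.≤-trans (0≤ι (den x)) (p≤p+q 0≤pt)) ⟨
        ∣ v * (z * q (x ++ w) - q⁻ (x ++ w)) ∣                 ≡⟨ cong ∣_∣ identity ⟩
        ∣ (p⁻ x * q x - p x * q⁻ x) * (q w * t - q⁻ w) ∣       ≡⟨ ℚ.∣p*q∣≡∣p∣*∣q∣ (p⁻ x * q x - p x * q⁻ x) _ ⟩
        ∣ p⁻ x * q x - p x * q⁻ x ∣ * ∣ q w * t - q⁻ w ∣       ≡⟨ cong (_* ∣ q w * t - q⁻ w ∣) (det x) ⟩
        1ℚ * ∣ q w * t - q⁻ w ∣                                ≡⟨ ℚ.*-identityˡ _ ⟩
        ∣ q w * t - q⁻ w ∣                                     ≤⟨ ∣p∣≤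
            (p≤q+r⇒p-q≤r (q w * t) (q⁻ w) (q w) (ℚ.≤-trans ct≤c (ℚ.≤-trans (p≤p+q (0≤ι (den⁻ w))) (ℚ.≤-reflexive (ℚ.+-comm (q w) (q⁻ w))))))
            (begin
              - (q w * t - q⁻ w)    ≡⟨ solve 2 (λ a b → :- (a :- b) := b :- a) refl (q w * t) (q⁻ w) ⟩
              q⁻ w - q w * t        ≤⟨ p≤q+r⇒p-q≤r (q⁻ w) (q w * t) (q w) (ℚ.≤-trans (ι-mono (den⁻≤den hw))
                                         (ℚ.≤-trans (p≤p+q (0≤p*q (0≤ι (den w)) 0≤t)) (ℚ.≤-reflexive (ℚ.+-comm (q w) (q w * t))))) ⟩
              q w                   ∎) ⟩
        q w                                                    ∎

    ι-cont-++-∷ : ∀ a b d x u → ι (cont a b (x ++ d ∷ u)) ≡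
                  ι (cont a b u) * p x + (ι (cont⁻ a b u) + ι d * ι (cont a b u)) * q x
    ι-cont-++-∷ a b d x u = trans (ι-cont-++ a b x (d ∷ u))
      (cong (λ z → ι (cont a b u) * p x + z * q x) (ι-cont a b d u))

    -- [0; 1, …] ≥ 1/2 and [0; 3, …] ≤ 1/3, whereas the digits 1 and 2 would leave no gap.
    separated : ∀ {x y u} (h : Word K (x ++ 1 ∷ u)) (h′ : Word K (y ++ 3 ∷ u)) →
                1ℚ ≤ ι 15 * (q u * q u) * ∣ value h - value h′ ∣
    separated {x} {y} {u} h h′ = *-cancelˡ (q x * q y) (0<p*q (q-pos hx) (q-pos hy)) (begin
      q x * q y * 1ℚ
        ≡⟨ ℚ.*-identityʳ (q x * q y) ⟩
      q x * q y
        ≤⟨ p≤p+q (ℚ.≤-trans (0≤p*q (0≤ι (den x)) (0≤ι (num y))) (p≤p+q (0≤p*q (0≤ι (den y)) 0≤q-p))) ⟩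
      e
        ≤⟨ p≤∣p∣ e ⟩
      ∣ e ∣
        ≡⟨ ℚ.*-identityˡ _ ⟨
      1ℚ * ∣ e ∣
        ≡⟨ cong (_* ∣ e ∣) (det u) ⟨
      ∣ p⁻ u * q u - p u * q⁻ u ∣ * ∣ e ∣
        ≡⟨ ℚ.∣p*q∣≡∣p∣*∣q∣ (p⁻ u * q u - p u * q⁻ u) e ⟨
      ∣ (p⁻ u * q u - p u * q⁻ u) * e ∣
        ≡⟨ cong ∣_∣ identity ⟩
      ∣ p X * q Y - p Y * q X ∣
        ≡⟨ cong₂ (λ a b → ∣ a * q Y - b * q X ∣) (q*value h) (q*value h′) ⟨
      ∣ q X * value h * q Y - q Y * value h′ * q X ∣
        ≡⟨ cong ∣_∣ (solve 4 (λ a b v v′ → a :* v :* b :- b :* v′ :* a := a :* b :* (v :- v′)) refl (q X) (q Y) (value h) (value h′)) ⟩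
      ∣ q X * q Y * (value h - value h′) ∣
        ≡⟨ ∣p*q∣≡p*∣q∣ (value h - value h′) (0≤p*q (0≤ι (den X)) (0≤ι (den Y))) ⟩
      q X * q Y * δ
        ≤⟨ *-monoʳ δ (ℚ.0≤∣p∣ (value h - value h′)) (*-mono-≤ (0≤ι (den X))
            (0≤p*q (0≤p*q (0≤ι 5) (0≤ι (den u))) (0≤ι (den y))) (q-++-∷≤ 1 hx) (q-++-∷≤ 3 hy)) ⟩
      (ι 3 * q u * q x) * (ι 5 * q u * q y) * δ
        ≡⟨ solve 4 (λ u x y e → (con (ι 3) :* u :* x) :* (con (ι 5) :* u :* y) :* e := x :* y :* (con (ι 15) :* (u :* u) :* e)) refl (q u) (q x) (q y) δ ⟩
      q x * q y * (ι 15 * (q u * q u) * δ) ∎)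
      where
      X Y : List ℕ
      X = x ++ 1 ∷ u
      Y = y ++ 3 ∷ u
      hx = ++⁻ˡ x h
      hy = ++⁻ˡ y h′
      hu : Word K u
      hu = All.tail (++⁻ʳ x h)
      δ e : ℚ
      δ = ∣ value h - value h′ ∣
      -- This is `q x * q y` times (3 + p y / q y) - (1 + p x / q x), the difference of the complete
      -- quotients following `u`, arranged so that every summand is visibly nonnegative.
      e = q x * q y + (q x * p y + q y * (q x - p x))
      0≤q-p : 0ℚ ≤ q x - p x
      0≤q-p = subst (_≤ q x - p x) (ℚ.+-inverseʳ (p x)) (ℚ.+-monoˡ-≤ (- p x) (ι-mono (num≤den hx)))
      identity : (p⁻ u * q u - p u * q⁻ u) * e ≡ p X * q Y - p Y * q X
      identity = begin-equality
        (p⁻ u * q u - p u * q⁻ u) * e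
          ≡⟨ solve 8 (λ a b c d px qx py qy →
              (a :* d :- b :* c) :* (qx :* qy :+ (qx :* py :+ qy :* (qx :- px))) :=
              (b :* px :+ (a :+ con 1ℚ :* b) :* qx) :* (d :* py :+ (c :+ con (ι 3) :* d) :* qy)
              :- (b :* py :+ (a :+ con (ι 3) :* b) :* qy) :* (d :* px :+ (c :+ con 1ℚ :* d) :* qx)) refl
            (p⁻ u) (p u) (q⁻ u) (q u) (p x) (q x) (p y) (q y) ⟩
        (p u * p x + (p⁻ u + ι 1 * p u) * q x) * (q u * p y + (q⁻ u + ι 3 * q u) * q y)
          - (p u * p y + (p⁻ u + ι 3 * p u) * q y) * (q u * p x + (q⁻ u + ι 1 * q u) * q x)
          ≡⟨ cong₂ _-_ (cong₂ _*_ (ι-cont-++-∷ 1 0 1 x u) (ι-cont-++-∷ 0 1 3 y u))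
                       (cong₂ _*_ (ι-cont-++-∷ 1 0 3 y u) (ι-cont-++-∷ 0 1 1 x u)) ⟨
        p X * q Y - p Y * q X ∎
      -- The digits 1 and 3 give the factors 3 and 5, whence the constant 15.
      q-++-∷≤ : ∀ d {x} → Word K x → q (x ++ d ∷ u) ≤ ι (2 ℕ.+ d) * q u * q x
      q-++-∷≤ d {x} hx = begin
        q (x ++ d ∷ u)
          ≡⟨ ι-cont-++-∷ 0 1 d x u ⟩
        q u * p x + (q⁻ u + ι d * q u) * q x
          ≤⟨ ℚ.+-mono-≤ (*-monoˡ (q u) (0≤ι (den u)) (ι-mono (num≤den hx)))
               (*-monoʳ (q x) (0≤ι (den x)) (ℚ.+-monoˡ-≤ (ι d * q u) (ι-mono (den⁻≤den hu)))) ⟩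
        q u * q x + (q u + ι d * q u) * q x
          ≡⟨ solve 3 (λ u x d → u :* x :+ (u :+ d :* u) :* x := (con 2ℚ :+ d) :* u :* x) refl (q u) (q x) (ι d) ⟩
        (ι 2 + ι d) * q u * q x
          ≡⟨ cong (λ z → z * q u * q x) (ι-+ 2 d) ⟨
        ι (2 ℕ.+ d) * q u * q x ∎

-- The family of badly approximable numbers coded by binary sequences.

module Construction where
  open import Data.Rational using (_+_; _-_; _*_; -_; _≤_; _<_; ∣_∣)
  open Rational hiding (‖_‖)
  open ℚ.≤-Reasoning
  open +-*-Solver using (solve; _:=_; _:+_; _:*_; _:-_; :-_; con)
  open Arithmetic
  open Continuants

  infix 4 _⊑_

  -- Words carry their last digit first, so this suffix order says that the expansion `v` continues
  -- the expansion `w`.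
  _⊑_ : List ℕ → List ℕ → Set
  w ⊑ v = ∃ λ x → v ≡ x ++ w

  ⊑-refl : ∀ {w} → w ⊑ w
  ⊑-refl = [] , refl

  ⊑-trans : ∀ {u v w} → u ⊑ v → v ⊑ w → u ⊑ w
  ⊑-trans {u} (x , refl) (y , refl) = y ++ x , sym (++-assoc y x u)

  module _ {K : ℕ} where

    ⊑-convergent : ∀ {w v} → w ⊑ v → (h : Word K v) → ∣ q w * value h - p w ∣ * q w ≤ 1ℚ
    ⊑-convergent {w} (x , refl) h = convergent {x = x} {w} (++⁻ˡ x h) h

    ⊑-badly : ∀ {w v} → w ⊑ v → (h : Word K v) → ∀ n k → 0 ℕ.< n → 2 ℕ.* n ℕ.≤ den w →
              1ℚ ≤ ι (suc K) * (4ℚ * (ι n * ∣ ι n * value h - ⟨ k ⟩ ∣))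
    ⊑-badly {w} (x , refl) = badly {x = x} w

    ⊑-separated : ∀ {u v v′} → 1 ∷ u ⊑ v → 3 ∷ u ⊑ v′ → (h : Word K v) (h′ : Word K v′) →
                  1ℚ ≤ ι 15 * (q u * q u) * ∣ value h - value h′ ∣
    ⊑-separated {u} (x , refl) (y , refl) = separated {x = x} {y} {u}

    value-cong : ∀ {w v} (h : Word K w) (h′ : Word K v) → w ≡ v → value h ≡ value h′
    value-cong h h′ refl = refl

    close : ∀ {w v} → w ⊑ v → (h : Word K w) (h′ : Word K v) → ∣ value h′ - value h ∣ * q w ≤ 1ℚ
    close {w} w⊑v h h′ = begin
      ∣ value h′ - value h ∣ * q w            ≡⟨ ℚ.*-comm _ (q w) ⟩
      q w * ∣ value h′ - value h ∣            ≡⟨ ∣p*q∣≡p*∣q∣ _ (0≤ι (den w)) ⟨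
      ∣ q w * (value h′ - value h) ∣          ≡⟨ cong ∣_∣ (solve 3 (λ q a b → q :* (a :- b) := q :* a :- q :* b) refl (q w) (value h′) (value h)) ⟩
      ∣ q w * value h′ - q w * value h ∣      ≡⟨ cong (λ z → ∣ q w * value h′ - z ∣) (q*value h) ⟩
      e                                       ≡⟨ ℚ.*-identityʳ e ⟨
      e * 1ℚ                                  ≤⟨ *-monoˡ e (ℚ.0≤∣p∣ _) (1≤q h) ⟩
      e * q w                                 ≤⟨ ⊑-convergent w⊑v h′ ⟩
      1ℚ                                      ∎
      where
      e : ℚ
      e = ∣ q w * value h′ - p w ∣

  module Interleaving
    (K : ℕ) (3≤K : 3 ℕ.≤ K)
    (digits : ℕ → ℕ → ℕ) (digits-bounded : ∀ i j → Digit K (digits i j))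
    (size : List ℕ → ℕ)
    where

    -- Digit 0 stands at the head and is therefore read last: the reversal required by the mirror
    -- formula comes from the encoding of words.
    block : ℕ → List ℕ → List ℕ
    block i w = applyUpTo (digits i) (size w)

    -- A triangular schedule: stage n of `word` runs the blocks 0 to n, so index i recurs in every
    -- stage from i on, and each block is sized by the entire word before it.
    rounds : ℕ → List ℕ → List ℕ
    rounds zero    w = w
    rounds (suc i) w = block i (rounds i w) ++ rounds i w

    bit : Bool → ℕ
    bit true  = 1
    bit false = 3

    word : (ℕ → Bool) → ℕ → List ℕ
    word s zero    = []
    word s (suc n) = bit (s n) ∷ rounds (suc n) (word s n)

    block-Word : ∀ i w → Word K (block i w)
    block-Word i w = applyUpTo⁺₂ (digits i) (size w) (digits-bounded i)

    rounds-Word : ∀ i {w} → Word K w → Word K (rounds i w)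
    rounds-Word zero    h = h
    rounds-Word (suc i) h = ++⁺ (block-Word i _) (rounds-Word i h)

    bit-Digit : ∀ b → Digit K (bit b)
    bit-Digit true  = ℕ.≤-refl , ℕ.≤-trans (ℕ.s≤s ℕ.z≤n) 3≤K
    bit-Digit false = ℕ.s≤s ℕ.z≤n , 3≤K

    word-Word : ∀ s n → Word K (word s n)
    word-Word s zero    = []
    word-Word s (suc n) = bit-Digit (s n) ∷ rounds-Word (suc n) (word-Word s n)

    ⊑-rounds : ∀ i j {w} → rounds i w ⊑ rounds (j ℕ.+ i) w
    ⊑-rounds i zero        = ⊑-refl
    ⊑-rounds i (suc j) {w} = ⊑-trans (⊑-rounds i j) (block (j ℕ.+ i) (rounds (j ℕ.+ i) w) , refl)

    rounds⊑word : ∀ s n → rounds (suc n) (word s n) ⊑ word s (suc n)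
    rounds⊑word s n = bit (s n) ∷ [] , refl

    word⊑ : ∀ s {m n} → m ℕ.≤′ n → word s m ⊑ word s n
    word⊑ s ℕ.≤′-refl = ⊑-refl
    word⊑ s (ℕ.≤′-step {n} m≤n) = ⊑-trans (word⊑ s m≤n)
      (⊑-trans (subst (λ k → word s n ⊑ rounds k (word s n)) (ℕ.+-identityʳ (suc n)) (⊑-rounds 0 (suc n))) (rounds⊑word s n))

    word-mono : ∀ s {m n} → m ℕ.≤ n → word s m ⊑ word s n
    word-mono s m≤n = word⊑ s (ℕ.≤⇒≤′ m≤n)

    ⊑⇒length≤ : ∀ {w v} → w ⊑ v → length w ℕ.≤ length v
    ⊑⇒length≤ {w} (x , refl) = subst (length w ℕ.≤_) (sym (length-++ x)) (ℕ.m≤n+m _ (length x))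

    n≤length : ∀ s n → n ℕ.≤ length (word s n)
    n≤length s zero    = ℕ.z≤n
    n≤length s (suc n) = ℕ.s≤s (ℕ.≤-trans (n≤length s n) (⊑⇒length≤
      (subst (λ k → word s n ⊑ rounds k (word s n)) (ℕ.+-identityʳ (suc n)) (⊑-rounds 0 (suc n)))))

    n≤den : ∀ s n → n ℕ.≤ den (word s n)
    n≤den s n = ℕ.≤-trans (n≤length s n) (length≤den (word-Word s n))

    term : (ℕ → Bool) → ℕ → ℚ
    term s n = value (word-Word s n)

    term-cauchy : ∀ s ε → 0ℚ < ε → ∃ λ N → ∀ n → N ℕ.≤ n → ∣ term s n - term s N ∣ ≤ ε
    term-cauchy s ε 0<ε = N , λ n N≤n →
      let d = ∣ term s n - term s N ∣ in
      *-cancelˡ (q (word s N)) (q-pos (word-Word s N)) (begin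
        q (word s N) * d       ≡⟨ ℚ.*-comm (q (word s N)) d ⟩
        d * q (word s N)       ≤⟨ close (word-mono s N≤n) (word-Word s N) (word-Word s n) ⟩
        1ℚ                     ≤⟨ 1≤εN ⟩
        ε * ι N                ≤⟨ *-monoˡ ε (ℚ.<⇒≤ 0<ε) (ι-mono (n≤den s N)) ⟩
        ε * q (word s N)       ≡⟨ ℚ.*-comm ε (q (word s N)) ⟩
        q (word s N) * ε       ∎)
      where
      N = proj₁ (archimedean ε 0<ε)
      1≤εN = proj₂ (archimedean ε 0<ε)

    point : (ℕ → Bool) → ℝ
    point s .seq n = term s n
    point s .cauchy ε 0<ε =
      let N , h = term-cauchy s (ε * ½) (0<p*q 0<ε ½>0) in
      N , λ m n N≤m N≤n → begin
        ∣ term s m - term s n ∣                              ≤⟨ ∣p-q∣≤∣p-r∣+∣r-q∣ (term s m) (term s N) (term s n) ⟩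
        ∣ term s m - term s N ∣ + ∣ term s N - term s n ∣    ≡⟨ cong (λ z → ∣ term s m - term s N ∣ + z) (∣p-q∣≡∣q-p∣ (term s N) (term s n)) ⟩
        ∣ term s m - term s N ∣ + ∣ term s n - term s N ∣    ≤⟨ ℚ.+-mono-≤ (h m N≤m) (h n N≤n) ⟩
        ε * ½ + ε * ½                                        ≡⟨ halves ε ⟩
        ε                                                    ∎

    word-cong : ∀ {s t} → s ≗ t → ∀ n → word s n ≡ word t n
    word-cong s≗t zero    = refl
    word-cong s≗t (suc n) = cong₂ (λ b w → bit b ∷ rounds (suc n) w) (s≗t n) (word-cong s≗t n)

    point-cong : Congruent _≗_ _≃_ point
    point-cong {s} {t} s≗t ε 0<ε = 0 , λ n _ →
      ≡⇒∣p-q∣≤ (value-cong (word-Word s n) (word-Word t n) (word-cong s≗t n)) 0<ε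

    point-bad : ∀ s → Bad (point s)
    point-bad s = Defs.fromℚ c , (c , 0<c , 0 , λ _ _ → ℚ.≤-reflexive (ℚ.+-identityˡ c)) ,
      -- The word of stage 2n has denominator at least 2n, which is what `badly` asks for; the
      -- constant is c = 1 / (4 (K + 1)).
      λ n ε 0<ε → 2 ℕ.* n , λ m 2n≤m → ℚ.≤-trans (c≤ n (ℕ.>-nonZero⁻¹ n) m 2n≤m) (p≤p+q (ℚ.<⇒≤ 0<ε))
      where
      C c : ℚ
      C = ι (suc K) * 4ℚ
      0<C : 0ℚ < C
      0<C = 0<p*q (⟨⟩-pos {suc K} (ℕ.s≤s ℕ.z≤n)) (⟨⟩-pos {4} (ℕ.s≤s ℕ.z≤n))
      c = inv C 0<C
      0<c : 0ℚ < c
      0<c = inv-pos C 0<C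
      c≤ : ∀ n → 0 ℕ.< n → ∀ m → 2 ℕ.* n ℕ.≤ m → c ≤ ι n * Rational.‖ ι n * term s m ‖
      c≤ n 0<n m 2n≤m = let k , eq = ‖p‖-attained (ι n * term s m) in *-cancelˡ C 0<C (begin
        C * c                                                        ≡⟨ *-inv C 0<C ⟩
        1ℚ                                                           ≤⟨ ⊑-badly (word-mono s 2n≤m) (word-Word s m) n k 0<n (n≤den s (2 ℕ.* n)) ⟩
        ι (suc K) * (4ℚ * (ι n * ∣ ι n * term s m - ⟨ k ⟩ ∣))        ≡⟨ ℚ.*-assoc (ι (suc K)) 4ℚ _ ⟨
        C * (ι n * ∣ ι n * term s m - ⟨ k ⟩ ∣)                       ≡⟨ cong (λ z → C * (ι n * z)) eq ⟨
        C * (ι n * Rational.‖ ι n * term s m ‖)                      ∎)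

    -- The gap 1/C depends only on the common part `u`, so it persists in all later terms; equality
    -- to within 1/(2C) would then give 1 ≤ 1/2.
    distinct : ∀ {s t u} n → 1 ∷ u ⊑ word s n → 3 ∷ u ⊑ word t n → Word K u → ¬ point s ≃ point t
    distinct {s} {t} {u} n s-ext t-ext hu s≃t =
      let N , h = s≃t ε (0<p*q (inv-pos C 0<C) ½>0)
          m = n ℕ.⊔ N
      in ℚ.<-irrefl refl (ℚ.<-≤-trans ½<1 (begin
        1ℚ                             ≤⟨ ⊑-separated (⊑-trans s-ext (word-mono s (ℕ.m≤m⊔n n N))) (⊑-trans t-ext (word-mono t (ℕ.m≤m⊔n n N)))
                                            (word-Word s m) (word-Word t m) ⟩
        C * ∣ term s m - term t m ∣    ≤⟨ *-monoˡ C (ℚ.<⇒≤ 0<C) (h m (ℕ.m≤n⊔m n N)) ⟩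
        C * (inv C 0<C * ½)            ≡⟨ cong (C *_) (ℚ.*-comm (inv C 0<C) ½) ⟩
        C * (½ * inv C 0<C)            ≡⟨ *-inv-cancel C 0<C ½ ⟩
        ½                              ∎))
      where
      C : ℚ
      C = ι 15 * (q u * q u)
      0<C : 0ℚ < C
      0<C = 0<p*q (⟨⟩-pos {15} (ℕ.s≤s ℕ.z≤n)) (0<p*q (q-pos hu) (q-pos hu))
      ε : ℚ
      ε = inv C 0<C * ½
      ½<1 : ½ < 1ℚ
      ½<1 = ℚ.*<* (ℤ.+<+ (ℕ.s≤s (ℕ.s≤s ℕ.z≤n)))

    distinct-bit : ∀ {s t} n → word s n ≡ word t n → s n ≡ true → t n ≡ false → ¬ point s ≃ point t
    distinct-bit {s} {t} n eq sn tn = distinct {s} {t} (suc n)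
      ([] , cong (λ b → bit b ∷ rounds (suc n) (word s n)) sn)
      ([] , cong₂ (λ b w → bit b ∷ rounds (suc n) w) tn (sym eq))
      (rounds-Word (suc n) (word-Word s n))

    point-injective-at : ∀ {s t} → point s ≃ point t → ∀ n → word s n ≡ word t n → s n ≡ t n
    point-injective-at {s} {t} s≃t n eq = compare (s n) (t n) refl refl
      where
      compare : ∀ b c → s n ≡ b → t n ≡ c → s n ≡ t n
      compare true  true  sn tn = trans sn (sym tn)
      compare false false sn tn = trans sn (sym tn)
      compare true  false sn tn = contradiction s≃t (distinct-bit {s} {t} n eq sn tn)
      compare false true  sn tn = contradiction (≃-sym {point s} {point t} s≃t) (distinct-bit {t} {s} n (sym eq) tn sn)

    -- Bits are decoded one by one: equal words grow equal blocks, so the next bits follow the same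
    -- digits, and differing bits would separate the points.
    point-injective-word : ∀ {s t} → point s ≃ point t → ∀ n → word s n ≡ word t n
    point-injective-word s≃t zero    = refl
    point-injective-word {s} {t} s≃t (suc n) = cong₂ (λ b w → bit b ∷ rounds (suc n) w)
      (point-injective-at {s} {t} s≃t n eq) eq
      where eq = point-injective-word {s} {t} s≃t n

    point-injective : ∀ {s t} → point s ≃ point t → s ≗ t
    point-injective {s} {t} s≃t n = point-injective-at {s} {t} s≃t n (point-injective-word {s} {t} s≃t n)

    visit : ∀ s i N → ∃ λ w → Word K w × N ℕ.≤ length w × ∃ λ n → block i w ++ w ⊑ word s n
    visit s i N = rounds i (word s m) , rounds-Word i (word-Word s m) , long , suc m ,
      ⊑-trans (subst (λ k → rounds (suc i) (word s m) ⊑ rounds (suc k) (word s m)) (ℕ.m∸n+n≡m (ℕ.m≤m⊔n i N))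
        (subst (λ k → rounds (suc i) (word s m) ⊑ rounds k (word s m)) (ℕ.+-suc (m ℕ.∸ i) i) (⊑-rounds (suc i) (m ℕ.∸ i))))
        (rounds⊑word s m)
      where
      m : ℕ
      -- Stage m reaches block i because i ≤ m, and starts from a word of length at least N because
      -- N ≤ m.
      m = i ℕ.⊔ N
      long : N ℕ.≤ length (rounds i (word s m))
      long = ℕ.≤-trans (ℕ.m≤n⊔m i N) (ℕ.≤-trans (n≤length s m)
        (⊑⇒length≤ (subst (λ k → word s m ⊑ rounds k (word s m)) (ℕ.+-identityʳ i) (⊑-rounds 0 i))))

-- Partial quotients of a real number and the estimate for q‖qα‖.

module Expansion where
  open import Data.Rational using (_+_; _-_; _*_; -_; _≤_; _<_; ∣_∣)
  open Rational hiding (‖_‖)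
  open ℚ.≤-Reasoning
  open +-*-Solver using (solve; _:=_; _:+_; _:*_; _:-_; :-_; con)
  open Arithmetic
  open Continuants

  -- `recip` inverts the maximum of a term with ε. Past N this maximum is the term itself, so the
  -- identity is exact and not merely approximate.
  recip-inverse : ∀ x (0<x : 0ℝ Defs.< x) → ∃ λ N → ∀ m → N ℕ.≤ m →
                  0ℚ < seq x m × seq x m * seq (recip x 0<x) m ≡ 1ℚ
  recip-inverse x (ε , 0<ε , N , h) = N , λ m N≤m →
    let ε≤x = subst (_≤ seq x m) (ℚ.+-identityˡ ε) (h m N≤m) in
    ℚ.<-≤-trans 0<ε ε≤x ,
    trans (cong (λ z → z * inv⊔ ε 0<ε (seq x m)) (sym (ℚ.p≥q⇒p⊔q≡p ε≤x))) (*-inv (seq x m ℚ.⊔ ε) (0<p⊔ε (seq x m) 0<ε))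

  module _ {α : ℝ} {a : ℕ → ℤ} (c : α HasContinuedFraction a) where
    open _HasContinuedFraction_ c

    tail : ξ 1 HasContinuedFraction (a ∘ suc)
    tail = record
      { ξ = ξ ∘ suc ; ξ-zero = ≃-refl {ξ 1} ; a<ξ = a<ξ ∘ suc ; ξ<a+1 = ξ<a+1 ∘ suc ; ξ-suc = ξ-suc ∘ suc }

    head-≃ : ∀ {β} → α ≃ β → β HasContinuedFraction a
    head-≃ {β} α≃β = record
      { ξ = ξ ; ξ-zero = ≃-trans {ξ 0} {α} {β} ξ-zero α≃β ; a<ξ = a<ξ ; ξ<a+1 = ξ<a+1 ; ξ-suc = ξ-suc }

    fraction : ℕ → ℚ
    fraction m = seq (ξ 0) m - ⟨ a 0 ⟩

    -- The next complete quotient is only eventually close to the reciprocal r of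
    -- the fractional part.
    next : ∀ δ → 0ℚ < δ → ∃ λ N → ∀ m → N ℕ.≤ m →
           0ℚ < fraction m × fraction m ≤ 1ℚ × ∃ λ r → fraction m * r ≡ 1ℚ × ∣ seq (ξ 1) m - r ∣ ≤ δ
    next δ 0<δ =
      let N₁ , f = recip-inverse (ξ 0 Defs.- fromℤ (a 0)) (x<y⇒0<y-x {fromℤ (a 0)} {ξ 0} (a<ξ 0))
          ε , 0<ε , N₂ , g = ξ<a+1 0
          N₃ , h = ξ-suc 0 δ 0<δ
      in N₁ ℕ.⊔ (N₂ ℕ.⊔ N₃) , λ m ≤m →
        let N₁≤m = ℕ.m⊔n≤o⇒m≤o N₁ (N₂ ℕ.⊔ N₃) ≤m
            ≤m′ = ℕ.m⊔n≤o⇒n≤o N₁ (N₂ ℕ.⊔ N₃) ≤m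
            0<y , yr≡1 = f m N₁≤m
        in 0<y
         , p≤q+r⇒p-q≤r (seq (ξ 0) m) ⟨ a 0 ⟩ 1ℚ (ℚ.≤-trans (p≤p+q (ℚ.<⇒≤ 0<ε)) (g m (ℕ.m⊔n≤o⇒m≤o N₂ N₃ ≤m′)))
         , _ , yr≡1 , h m (ℕ.m⊔n≤o⇒n≤o N₂ N₃ ≤m′)

    -- The fractional part is at most 1, so its reciprocal is at least 1 and ξ 1 is nearly so. The
    -- strict bound ξ 1 < a 1 + 1 has a margin ε; half of it absorbs the error and the other half
    -- keeps a 1 positive.
    0<a₁ : + 0 ℤ.< a 1
    0<a₁ = ℤ.≰⇒> λ a₁≤0 → ℚ.<-irrefl refl (ℚ.<-≤-trans 0<ε/2 (ℚ.≤-trans ε/2≤a₁ (⟨⟩-mono a₁≤0)))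
      where
      ε = proj₁ (ξ<a+1 1)
      0<ε/2 : 0ℚ < ε * ½
      0<ε/2 = 0<p*q (proj₁ (proj₂ (ξ<a+1 1))) ½>0
      ε/2≤a₁ : ε * ½ ≤ ⟨ a 1 ⟩
      ε/2≤a₁ =
        let _ , _ , N , g = ξ<a+1 1
            N′ , h = next (ε * ½) 0<ε/2
            m = N ℕ.⊔ N′
            y = fraction m
            x = seq (ξ 1) m
            0<y , y≤1 , r , yr≡1 , near = h m (ℕ.m≤n⊔m N N′)
            1≤r = *-cancelˡ y 0<y (ℚ.≤-trans (ℚ.≤-reflexive (ℚ.*-identityʳ y)) (ℚ.≤-trans y≤1 (ℚ.≤-reflexive (sym yr≡1))))
        in begin
          ε * ½                                    ≡⟨ solve 2 (λ e x → e := x :+ (e :+ e) :- (x :+ e)) refl (ε * ½) x ⟩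
          x + (ε * ½ + ε * ½) - (x + ε * ½)        ≡⟨ cong (λ z → x + z - (x + ε * ½)) (halves ε) ⟩
          x + ε - (x + ε * ½)                      ≤⟨ ℚ.+-mono-≤ (g m (ℕ.m≤m⊔n N N′)) (ℚ.neg-antimono-≤
                                                        (ℚ.≤-trans 1≤r (ℚ.≤-trans (q≤∣p-q∣+p x r) (ℚ.+-monoʳ-≤ x near)))) ⟩
          ⟨ a 1 ⟩ + 1ℚ - 1ℚ                        ≡⟨ solve 1 (λ a → a :+ con 1ℚ :- con 1ℚ := a) refl ⟨ a 1 ⟩ ⟩
          ⟨ a 1 ⟩                                  ∎

    ι∣a₁∣ : ι ℤ.∣ a 1 ∣ ≡ ⟨ a 1 ⟩
    ι∣a₁∣ = cong ⟨_⟩ (ℤ.0≤i⇒+∣i∣≡i (ℤ.<⇒≤ 0<a₁))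

  0<partialQuotient : ∀ {α a} → α HasContinuedFraction a → ∀ n → + 0 ℤ.< a (suc n)
  0<partialQuotient c zero    = 0<a₁ c
  0<partialQuotient c (suc n) = 0<partialQuotient (tail c) n

  digit : (ℕ → ℤ) → ℕ → ℕ
  digit a n = ℤ.∣ a (suc n) ∣

  1≤digit : ∀ {α a} → α HasContinuedFraction a → ∀ n → 1 ℕ.≤ digit a n
  1≤digit {a = a} c n = ℤ.drop‿+<+ (subst (+ 0 ℤ.<_) (sym (ℤ.0≤i⇒+∣i∣≡i (ℤ.<⇒≤ 0<a))) 0<a)
    where 0<a = 0<partialQuotient c n

  -- The added 1 is the tolerance at which the real inequality with M is read off in `digit≤`.
  digitBound : ℝ → ℕ
  digitBound M = ℤ.∣ ℚ.floor (proj₁ (bounded M) + 1ℚ) ∣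

  ∣∣-mono : ∀ {i j} → + 0 ℤ.≤ i → i ℤ.≤ j → ℤ.∣ i ∣ ℕ.≤ ℤ.∣ j ∣
  ∣∣-mono (ℤ.+≤+ _) (ℤ.+≤+ m≤n) = m≤n

  digit≤ : ∀ {M α a} → α HasContinuedFraction a → (∀ n → fromℤ (a (suc n)) Defs.≤ M) → ∀ n → digit a n ℕ.≤ digitBound M
  digit≤ {M} {a = a} c a≤M n =
    let L , _ , N , f = bounded M
        N′ , g = a≤M n 1ℚ (ℚ.positive⁻¹ 1ℚ)
        m = N ℕ.⊔ N′
    in ∣∣-mono (ℤ.<⇒≤ (0<partialQuotient c n)) (k≤p⇒k≤⌊p⌋ (a (suc n)) (L + 1ℚ) (begin
      ⟨ a (suc n) ⟩        ≤⟨ g m (ℕ.m≤n⊔m N N′) ⟩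
      seq M m + 1ℚ         ≤⟨ ℚ.+-monoˡ-≤ 1ℚ (ℚ.≤-trans (p≤∣p∣ (seq M m)) (f m (ℕ.m≤m⊔n N N′))) ⟩
      L + 1ℚ               ∎))

  -- `mirror` needs an exact identity, but terms of successive complete quotients are related only
  -- up to an error. Hence z is rebuilt outwards from an innermost t as [0; a 1, ..., a k + t],
  -- which satisfies the identity exactly and stays within δ of the fractional part.
  expansion : ∀ k {α a} (c : α HasContinuedFraction a) δ → 0ℚ < δ → let x = applyUpTo (digit a) k in
              ∃ λ N → ∀ m → N ℕ.≤ m → ∃ λ z → ∃ λ t → 0ℚ ≤ t × t ≤ 1ℚ × 0ℚ ≤ z × z ≤ 1ℚ ×
              z * (q x + p x * t) ≡ q⁻ x + p⁻ x * t × ∣ fraction c m - z ∣ ≤ δ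
  expansion zero c δ 0<δ =
    let N , h = next c δ 0<δ in N , λ m N≤m →
    let 0<y , y≤1 , _ = h m N≤m
        y = fraction c m
    in y , y , ℚ.<⇒≤ 0<y , y≤1 , ℚ.<⇒≤ 0<y , y≤1 ,
       solve 1 (λ y → y :* (con 1ℚ :+ con 0ℚ :* y) := con 0ℚ :+ con 1ℚ :* y) refl y ,
       ≡⇒∣p-q∣≤ {y} refl 0<δ
  expansion (suc k) {a = a} c δ 0<δ =
    let N , f = next c (δ * ½) (0<p*q 0<δ ½>0)
        N′ , g = expansion k (tail c) (δ * ½) (0<p*q 0<δ ½>0)
    in N ℕ.⊔ N′ , λ m ≤m →
    let 0<y , y≤1 , r , yr≡1 , r-near = f m (ℕ.m⊔n≤o⇒m≤o N N′ ≤m)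
        z , t , 0≤t , t≤1 , 0≤z , z≤1 , eq , z-near = g m (ℕ.m⊔n≤o⇒n≤o N N′ ≤m)
    in step (fraction c m) 0<y y≤1 r yr≡1 (seq (_HasContinuedFraction_.ξ c 1) m) r-near z t 0≤t t≤1 0≤z eq z-near
    where
    x : List ℕ
    x = applyUpTo (digit (a ∘ suc)) k
    d : ℕ
    d = digit a 0
    1≤d : 1ℚ ≤ ι d
    1≤d = ι-mono (1≤digit c 0)
    step : ∀ y → 0ℚ < y → y ≤ 1ℚ → ∀ r → y * r ≡ 1ℚ → ∀ ξ₁ → ∣ ξ₁ - r ∣ ≤ δ * ½ →
           ∀ z t → 0ℚ ≤ t → t ≤ 1ℚ → 0ℚ ≤ z → z * (q x + p x * t) ≡ q⁻ x + p⁻ x * t → ∣ ξ₁ - ⟨ a 1 ⟩ - z ∣ ≤ δ * ½ →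
           ∃ λ z → ∃ λ t → 0ℚ ≤ t × t ≤ 1ℚ × 0ℚ ≤ z × z ≤ 1ℚ ×
           z * (q (d ∷ x) + p (d ∷ x) * t) ≡ q⁻ (d ∷ x) + p⁻ (d ∷ x) * t × ∣ y - z ∣ ≤ δ
    step y 0<y y≤1 r yr≡1 ξ₁ r-near z t 0≤t t≤1 0≤z eq z-near =
      z′ , t , 0≤t , t≤1 , 0≤z′ , z′≤1 , eq′ , near
      where
      s z′ : ℚ
      s = ι d + z
      1≤s : 1ℚ ≤ s
      1≤s = ℚ.≤-trans 1≤d (p≤p+q 0≤z)
      0<s : 0ℚ < s
      0<s = ℚ.<-≤-trans (ℚ.positive⁻¹ 1ℚ) 1≤s
      z′ = inv s 0<s
      0≤z′ : 0ℚ ≤ z′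
      0≤z′ = ℚ.<⇒≤ (inv-pos s 0<s)
      z′≤1 : z′ ≤ 1ℚ
      z′≤1 = begin
        z′           ≡⟨ ℚ.*-identityˡ z′ ⟨
        1ℚ * z′      ≤⟨ *-monoʳ z′ 0≤z′ 1≤s ⟩
        s * z′       ≡⟨ *-inv s 0<s ⟩
        1ℚ           ∎
      eq′ : z′ * (q (d ∷ x) + p (d ∷ x) * t) ≡ q x + p x * t
      eq′ = begin-equality
        z′ * (q (d ∷ x) + p (d ∷ x) * t)
          ≡⟨ cong₂ (λ u v → z′ * (u + v * t)) (ι-cont 0 1 d x) (ι-cont 1 0 d x) ⟩
        z′ * (q⁻ x + ι d * q x + (p⁻ x + ι d * p x) * t)
          ≡⟨ solve 7 (λ z′ a b c e d t → z′ :* (c :+ d :* e :+ (a :+ d :* b) :* t) := z′ :* (c :+ a :* t :+ d :* (e :+ b :* t))) refl z′ (p⁻ x) (p x) (q⁻ x) (q x) (ι d) t ⟩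
        z′ * (q⁻ x + p⁻ x * t + ι d * (q x + p x * t))
          ≡⟨ cong (λ u → z′ * (u + ι d * (q x + p x * t))) eq ⟨
        z′ * (z * (q x + p x * t) + ι d * (q x + p x * t))
          ≡⟨ solve 4 (λ z′ z d v → z′ :* (z :* v :+ d :* v) := (d :+ z) :* (v :* z′)) refl z′ z (ι d) (q x + p x * t) ⟩
        s * ((q x + p x * t) * z′)
          ≡⟨ *-inv-cancel s 0<s (q x + p x * t) ⟩
        q x + p x * t ∎
      s-r : ∣ s - r ∣ ≤ δ
      s-r = begin
        ∣ s - r ∣                                   ≤⟨ ∣p-q∣≤∣p-r∣+∣r-q∣ s ξ₁ r ⟩
        ∣ s - ξ₁ ∣ + ∣ ξ₁ - r ∣                     ≡⟨ cong (λ u → u + ∣ ξ₁ - r ∣) (∣p-q∣≡∣q-p∣ s ξ₁) ⟩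
        ∣ ξ₁ - s ∣ + ∣ ξ₁ - r ∣                     ≡⟨ cong (λ u → ∣ u ∣ + ∣ ξ₁ - r ∣) (solve 3 (λ x d z → x :- (d :+ z) := x :- d :- z) refl ξ₁ (ι d) z) ⟩
        ∣ ξ₁ - ι d - z ∣ + ∣ ξ₁ - r ∣               ≡⟨ cong (λ u → ∣ ξ₁ - u - z ∣ + ∣ ξ₁ - r ∣) (ι∣a₁∣ c) ⟩
        ∣ ξ₁ - ⟨ a 1 ⟩ - z ∣ + ∣ ξ₁ - r ∣           ≤⟨ ℚ.+-mono-≤ z-near r-near ⟩
        δ * ½ + δ * ½                               ≡⟨ halves δ ⟩
        δ                                           ∎
      -- As y = 1/r and z′ = 1/s both lie in [0, 1], inversion does not enlarge distances; the
      -- errors only add up, hence the halving of δ at each level.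
      near : ∣ y - z′ ∣ ≤ δ
      near = begin
        ∣ y - z′ ∣                                  ≡⟨ cong ∣_∣ (cong₂ _-_ (ℚ.*-identityʳ y) (ℚ.*-identityʳ z′)) ⟨
        ∣ y * 1ℚ - z′ * 1ℚ ∣                        ≡⟨ cong₂ (λ u v → ∣ y * u - z′ * v ∣) (*-inv s 0<s) yr≡1 ⟨
        ∣ y * (s * z′) - z′ * (y * r) ∣             ≡⟨ cong ∣_∣ (solve 4 (λ y s z r → y :* (s :* z) :- z :* (y :* r) := y :* z :* (s :- r)) refl y s z′ r) ⟩
        ∣ y * z′ * (s - r) ∣                        ≡⟨ ∣p*q∣≡p*∣q∣ (s - r) (0≤p*q (ℚ.<⇒≤ 0<y) 0≤z′) ⟩
        y * z′ * ∣ s - r ∣                          ≤⟨ *-monoʳ ∣ s - r ∣ (ℚ.0≤∣p∣ (s - r)) (*-mono-≤ {q = 1ℚ} {s = 1ℚ} (ℚ.<⇒≤ 0<y) (ℚ.<⇒≤ (ℚ.positive⁻¹ 1ℚ)) y≤1 z′≤1) ⟩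
        1ℚ * ∣ s - r ∣                              ≡⟨ ℚ.*-identityˡ ∣ s - r ∣ ⟩
        ∣ s - r ∣                                   ≤⟨ s-r ⟩
        δ                                           ∎

  approximated : ∀ {K α a} (c : α HasContinuedFraction a) k {w} → Word K (applyUpTo (digit a) k) → Word K w →
                 let Q = q (applyUpTo (digit a) k ++ w) in
                 ∃ λ N → ∀ m → N ℕ.≤ m → Q * Rational.‖ Q * seq α m ‖ ≤ 2ℚ * (q w * q w) + 1ℚ
  approximated {K} {α} {a} c k {w} hx hw =
    let N , f = expansion k c δ 0<δ
        N′ , g = _HasContinuedFraction_.ξ-zero c δ 0<δ
    in N ℕ.⊔ N′ , λ m ≤m →
    let z , t , 0≤t , t≤1 , _ , _ , eq , z-near = f m (ℕ.m⊔n≤o⇒m≤o N N′ ≤m)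
    in bound (seq α m) (seq (_HasContinuedFraction_.ξ c 0) m) z t 0≤t t≤1 eq z-near (g m (ℕ.m⊔n≤o⇒n≤o N N′ ≤m))
    where
    x X : List ℕ
    x = applyUpTo (digit a) k
    X = x ++ w
    Q : ℚ
    Q = q X
    0<Q : 0ℚ < Q
    0<Q = q-pos (++⁺ hx hw)
    δ : ℚ
    -- Two errors of size δ, each multiplied by Q², add up to the summand 1 of the bound.
    δ = ½ * inv (Q * Q) (0<p*q 0<Q 0<Q)
    0<δ : 0ℚ < δ
    0<δ = 0<p*q ½>0 (inv-pos (Q * Q) (0<p*q 0<Q 0<Q))
    nearest : ℤ
    -- By the mirror formula Q (α - a 0) is close to `q⁻ X`. Any integer bounds the distance from
    -- above, so it need not be shown to be the nearest.
    nearest = + den X ℤ.* a 0 ℤ.+ + den⁻ X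
    bound : ∀ α ξ₀ z t → 0ℚ ≤ t → t ≤ 1ℚ → z * (q x + p x * t) ≡ q⁻ x + p⁻ x * t →
            ∣ ξ₀ - ⟨ a 0 ⟩ - z ∣ ≤ δ → ∣ ξ₀ - α ∣ ≤ δ →
            Q * Rational.‖ Q * α ‖ ≤ 2ℚ * (q w * q w) + 1ℚ
    bound α ξ₀ z t 0≤t t≤1 eq z-near α-near = begin
      Q * Rational.‖ Q * α ‖
        ≤⟨ *-monoˡ Q (ℚ.<⇒≤ 0<Q) (‖p‖≤∣p-k∣ (Q * α) nearest) ⟩
      Q * ∣ Q * α - ⟨ nearest ⟩ ∣
        ≡⟨ cong (λ u → Q * ∣ Q * α - u ∣) (trans (⟨⟩-+ (+ den X ℤ.* a 0) (+ den⁻ X)) (cong (_+ q⁻ X) (⟨⟩-* (+ den X) (a 0)))) ⟩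
      Q * ∣ Q * α - (Q * ⟨ a 0 ⟩ + q⁻ X) ∣
        ≡⟨ cong (λ u → Q * ∣ u ∣) (solve 6 (λ Q α ξ a z e → Q :* α :- (Q :* a :+ e) := (z :* Q :- e) :+ Q :* ((ξ :- a :- z) :- (ξ :- α))) refl Q α ξ₀ ⟨ a 0 ⟩ z (q⁻ X)) ⟩
      Q * ∣ (z * Q - q⁻ X) + Q * ((ξ₀ - ⟨ a 0 ⟩ - z) - (ξ₀ - α)) ∣
        ≤⟨ *-monoˡ Q (ℚ.<⇒≤ 0<Q) (ℚ.∣p+q∣≤∣p∣+∣q∣ (z * Q - q⁻ X) (Q * ((ξ₀ - ⟨ a 0 ⟩ - z) - (ξ₀ - α)))) ⟩
      Q * (∣ z * Q - q⁻ X ∣ + ∣ Q * ((ξ₀ - ⟨ a 0 ⟩ - z) - (ξ₀ - α)) ∣)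
        ≡⟨ cong (λ u → Q * (∣ z * Q - q⁻ X ∣ + u)) (∣p*q∣≡p*∣q∣ ((ξ₀ - ⟨ a 0 ⟩ - z) - (ξ₀ - α)) (ℚ.<⇒≤ 0<Q)) ⟩
      Q * (∣ z * Q - q⁻ X ∣ + Q * ∣ (ξ₀ - ⟨ a 0 ⟩ - z) - (ξ₀ - α) ∣)
        ≤⟨ *-monoˡ Q (ℚ.<⇒≤ 0<Q) (ℚ.+-monoʳ-≤ ∣ z * Q - q⁻ X ∣ (*-monoˡ Q (ℚ.<⇒≤ 0<Q)
            (ℚ.≤-trans (ℚ.∣p-q∣≤∣p∣+∣q∣ (ξ₀ - ⟨ a 0 ⟩ - z) (ξ₀ - α)) (ℚ.+-mono-≤ z-near α-near)))) ⟩
      Q * (∣ z * Q - q⁻ X ∣ + Q * (δ + δ))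
        ≡⟨ solve 3 (λ Q e i → Q :* (e :+ Q :* (con ½ :* i :+ con ½ :* i)) := Q :* e :+ Q :* Q :* i) refl Q ∣ z * Q - q⁻ X ∣ (inv (Q * Q) (0<p*q 0<Q 0<Q)) ⟩
      Q * ∣ z * Q - q⁻ X ∣ + Q * Q * inv (Q * Q) (0<p*q 0<Q 0<Q)
        ≡⟨ cong (λ u → Q * ∣ z * Q - q⁻ X ∣ + u) (*-inv (Q * Q) (0<p*q 0<Q 0<Q)) ⟩
      Q * ∣ z * Q - q⁻ X ∣ + 1ℚ
        ≤⟨ ℚ.+-monoˡ-≤ 1ℚ (mirror hx hw z t 0≤t t≤1 eq) ⟩
      2ℚ * (q w * q w) + 1ℚ ∎

open import Defs
open Rational hiding (‖_‖)
open Arithmetic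
open Continuants
open Construction
open Expansion

-- The set B: approximation, closure under `≃`, uncountability.

module Littlewood
  (φ : Sequence) (φ-pos : ∀ q .{{_ : NonZero q}} → 0ℝ < φ q) (φ⟶0 : φ ⟶ 0ℝ)
  (M : ℝ) (A : Pred ℝ 0ℓ) (countable : Countable A) (A⊆ : A ⊆ PartialQuotientsBoundedBy M)
  where

  open ℚ.≤-Reasoning
  open +-*-Solver using (solve; _:=_; _:*_)

  enumeration : ℕ → Maybe ℝ
  enumeration = proj₁ countable

  enumeration∈A : ∀ i → Maybe.All (_∈ A) (enumeration i)
  enumeration∈A = proj₁ (proj₂ countable)

  K : ℕ
  K = 3 ℕ.+ digitBound M

  digitsOf : (x : Maybe ℝ) → Maybe.All (_∈ A) x → ℕ → ℕ
  -- A skipped index still gets a block; any admissible digit can fill it.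
  digitsOf nothing  _          _ = 1
  digitsOf (just _) (just α∈A)   = digit (proj₁ (A⊆ α∈A))

  digitsOf-bounded : ∀ x x∈A j → Digit K (digitsOf x x∈A j)
  digitsOf-bounded nothing  _          j = ℕ.≤-refl , ℕ.s≤s ℕ.z≤n
  digitsOf-bounded (just _) (just α∈A) j =
    let a , c , a≤M = A⊆ α∈A in 1≤digit c j , ℕ.≤-trans (digit≤ {M} c a≤M j) (ℕ.m≤n+m _ 3)

  bound : List ℕ → ℚ
  bound w = 2ℚ ℚ.* (q w ℚ.* q w) ℚ.+ 1ℚ

  0<bound : ∀ w → 0ℚ ℚ.< bound w
  0<bound w = ℚ.+-mono-≤-< (0≤p*q (0≤ι 2) (0≤p*q (0≤ι (den w)) (0≤ι (den w)))) (ℚ.positive⁻¹ 1ℚ)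

  φ-eventually-small : ∀ w → ∃ λ N → ∀ q .{{_ : NonZero q}} → N ℕ.≤ q → ∣ φ q - 0ℝ ∣ < fromℚ (inv (bound w) (0<bound w))
  φ-eventually-small w = φ⟶0 (fromℚ r) (r , inv-pos (bound w) (0<bound w) , 0 , λ _ _ → ℚ.≤-reflexive (ℚ.+-identityˡ r))
    where r = inv (bound w) (0<bound w)

  -- The threshold for φ itself serves as the block length, since the denominator of a word is at
  -- least its length.
  size : List ℕ → ℕ
  size w = proj₁ (φ-eventually-small w)

  open Interleaving K (ℕ.m≤m+n 3 _) (λ i → digitsOf (enumeration i) (enumeration∈A i))
    (λ i → digitsOf-bounded (enumeration i) (enumeration∈A i)) size public

  approximated-digitsOf : ∀ {α} x x∈A k {w} → Maybe.Any (_≃ α) x →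
    Word K (applyUpTo (digitsOf x x∈A) k) → Word K w →
    let Q = q (applyUpTo (digitsOf x x∈A) k ++ w) in
    ∃ λ N → ∀ m → N ℕ.≤ m → Q ℚ.* Rational.‖ Q ℚ.* seq α m ‖ ℚ.≤ bound w
  approximated-digitsOf {α} (just β) (just β∈A) k (just β≃α) =
    approximated (head-≃ (proj₁ (proj₂ (A⊆ β∈A))) {α} β≃α) k

  -- Here x, y, f and r stand for ‖Qα‖, ‖Qβ‖, φ(Q) and the right-hand side. After multiplication by
  -- Q f the bounds Q x ≤ B, f ≤ 1/B and y Q ≤ 1 combine to 1 = Q f r.
  product≤ : ∀ Q B x y f r → 0ℚ ℚ.≤ Q → (0<B : 0ℚ ℚ.< B) → 0ℚ ℚ.≤ y → Q ℚ.* x ℚ.≤ B → y ℚ.* Q ℚ.≤ 1ℚ →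
             f ℚ.≤ inv B 0<B → 0ℚ ℚ.< Q ℚ.* f → Q ℚ.* f ℚ.* r ≡ 1ℚ → Q ℚ.* x ℚ.* y ℚ.≤ r
  product≤ Q B x y f r 0≤Q 0<B 0≤y Qx≤B yQ≤1 f≤ 0<Qf Qfr≡1 = *-cancelˡ (Q ℚ.* f) 0<Qf (begin
    Q ℚ.* f ℚ.* (Q ℚ.* x ℚ.* y)          ≤⟨ *-monoˡ _ (ℚ.<⇒≤ 0<Qf) (*-monoʳ y 0≤y Qx≤B) ⟩
    Q ℚ.* f ℚ.* (B ℚ.* y)                ≤⟨ *-monoʳ _ (0≤p*q (ℚ.<⇒≤ 0<B) 0≤y) (*-monoˡ Q 0≤Q f≤) ⟩
    Q ℚ.* inv B 0<B ℚ.* (B ℚ.* y)        ≡⟨ solve 4 (λ Q i B y → Q :* i :* (B :* y) := B :* (y :* Q :* i)) refl Q (inv B 0<B) B y ⟩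
    B ℚ.* (y ℚ.* Q ℚ.* inv B 0<B)        ≡⟨ *-inv-cancel B 0<B (y ℚ.* Q) ⟩
    y ℚ.* Q                              ≤⟨ yQ≤1 ⟩
    1ℚ                                   ≡⟨ Qfr≡1 ⟨
    Q ℚ.* f ℚ.* r                        ∎)

  Approximable : ℝ → ℝ → (n : ℕ) → .{{NonZero n}} → Set
  Approximable α β n = fromℕ n * ‖ fromℕ n * α ‖ * ‖ fromℕ n * β ‖
    ≤ recip (fromℕ n * φ n) (0<x*y {fromℕ n} {φ n} (0<q n) (φ-pos n))

  approximable-at : ∀ {α β} s i {w m} n → Maybe.Any (_≃ α) (enumeration i) → point s ≃ β → Word K w →
                    block i w ++ w ⊑ word s m → den (block i w ++ w) ≡ suc n → Approximable α β (suc n)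
  approximable-at {α} {β} s i {w} {m} n e≃α s≃β hw ext den≡ ε 0<ε =
    let N₁ , f₁ = approximated-digitsOf {α} (enumeration i) (enumeration∈A i) (size w) {w} e≃α (block-Word i w) hw
        ε₂ , 0<ε₂ , N₂ , f₂ = proj₂ (φ-eventually-small w) (suc n) size≤
        N₃ , f₃ = recip-inverse (fromℕ (suc n) * φ (suc n)) (0<x*y {fromℕ (suc n)} {φ (suc n)} (0<q (suc n)) (φ-pos (suc n)))
        N₄ , f₄ = s≃β (ε ℚ.* inv (bound w ℚ.* Q) 0<BQ) (0<p*q 0<ε (inv-pos (bound w ℚ.* Q) 0<BQ))
    in m ℕ.⊔ (N₁ ℕ.⊔ (N₂ ℕ.⊔ (N₃ ℕ.⊔ N₄))) , λ k ≤k →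
      let m≤k = ℕ.m⊔n≤o⇒m≤o m _ ≤k
          ≤k₁ = ℕ.m⊔n≤o⇒n≤o m _ ≤k
          ≤k₂ = ℕ.m⊔n≤o⇒n≤o N₁ _ ≤k₁
          ≤k₃ = ℕ.m⊔n≤o⇒n≤o N₂ _ ≤k₂
          0<Qf , Qfr≡1 = f₃ k (ℕ.m⊔n≤o⇒m≤o N₃ N₄ ≤k₃)
          Q‖Qα‖≤B = subst (λ d → ι d ℚ.* Rational.‖ ι d ℚ.* seq α k ‖ ℚ.≤ bound w) den≡ (f₁ k (ℕ.m⊔n≤o⇒m≤o N₁ _ ≤k₁))
      in ℚ.≤-trans
        -- Along the terms of `point s` the inequality holds without error; the tolerance ε pays
        -- only for passing from `point s` to β.
        (perturb _ (bound w) Q (term s k) (seq β k) ε 0<BQ (0≤ι (suc n)) (0≤p*q (0≤ι (suc n)) (0≤‖ Q ℚ.* seq α k ‖)) Q‖Qα‖≤B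
          (f₄ k (ℕ.m⊔n≤o⇒n≤o N₃ N₄ ≤k₃)))
        (ℚ.+-monoˡ-≤ ε (product≤ Q (bound w) Rational.‖ Q ℚ.* seq α k ‖ Rational.‖ Q ℚ.* term s k ‖ (seq (φ (suc n)) k)
          _ (0≤ι (suc n)) (0<bound w) (0≤‖ Q ℚ.* term s k ‖)
          Q‖Qα‖≤B
          (subst (λ d → Rational.‖ ι d ℚ.* term s k ‖ ℚ.* ι d ℚ.≤ 1ℚ) den≡ (convergent-near k m≤k))
          (φ≤ (seq (φ (suc n)) k) ε₂ 0<ε₂ (f₂ k (ℕ.m⊔n≤o⇒m≤o N₂ _ ≤k₂)))
          0<Qf Qfr≡1))
    where
    Q : ℚ
    Q = ι (suc n)
    0<BQ : 0ℚ ℚ.< bound w ℚ.* Q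
    0<BQ = 0<p*q (0<bound w) (⟨⟩-pos {suc n} (ℕ.s≤s ℕ.z≤n))
    X : List ℕ
    X = block i w ++ w
    size≤ : size w ℕ.≤ suc n
    size≤ = subst₂ ℕ._≤_ (length-applyUpTo (digitsOf (enumeration i) (enumeration∈A i)) (size w)) den≡ (ℕ.≤-trans
      (subst (length (block i w) ℕ.≤_) (sym (length-++ (block i w))) (ℕ.m≤m+n _ (length w)))
      (length≤den (++⁺ (block-Word i w) hw)))
    convergent-near : ∀ k → m ℕ.≤ k → Rational.‖ q X ℚ.* term s k ‖ ℚ.* q X ℚ.≤ 1ℚ
    convergent-near k m≤k = ℚ.≤-trans (*-monoʳ (q X) (0≤ι (den X)) (‖p‖≤∣p-k∣ (q X ℚ.* term s k) (+ num X)))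
      (⊑-convergent (⊑-trans ext (word-mono s m≤k)) (word-Word s k))
    φ≤ : ∀ f ε → 0ℚ ℚ.< ε → ℚ.∣ f ℚ.- 0ℚ ∣ ℚ.+ ε ℚ.≤ inv (bound w) (0<bound w) → f ℚ.≤ inv (bound w) (0<bound w)
    φ≤ f ε 0<ε h = begin
      f                          ≡⟨ ℚ.+-identityʳ f ⟨
      f ℚ.- 0ℚ                   ≤⟨ p≤∣p∣ (f ℚ.- 0ℚ) ⟩
      ℚ.∣ f ℚ.- 0ℚ ∣             ≤⟨ p≤p+q (ℚ.<⇒≤ 0<ε) ⟩
      ℚ.∣ f ℚ.- 0ℚ ∣ ℚ.+ ε       ≤⟨ h ⟩
      inv (bound w) (0<bound w)  ∎

  infinitely-approximable : ∀ {α β} s → α ∈ A → point s ≃ β → InfinitelyManyPositive (Approximable α β)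
  infinitely-approximable {α} {β} s α∈A s≃β N =
    let i , e≃α = proj₂ (proj₂ countable) α α∈A
        w , hw , N<length , m , ext = visit s i (suc N)
        X = block i w ++ w
        N<den = ℕ.≤-trans N<length (ℕ.≤-trans (⊑⇒length≤ (block i w , refl)) (length≤den (++⁺ (block-Word i w) hw)))
        den≡ = sym (ℕ.suc-pred (den X) {{ℕ.>-nonZero (ℕ.≤-trans (ℕ.s≤s ℕ.z≤n) N<den)}})
    in ℕ.pred (den X) , ℕ.≤-pred (subst (suc N ℕ.≤_) den≡ N<den) ,
       approximable-at {α} {β} s i {w} {m} (ℕ.pred (den X)) e≃α s≃β hw ext den≡

  -- The image of `point`, closed under `≃`; a member carries the sequence that produces it, which
  -- the diagonal argument and the effective construction read off.
  B : Pred ℝ 0ℓ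
  B β = ∃ λ s → point s ≃ β

  B-respects-≃ : B Respects _≃_
  B-respects-≃ {x} {y} x≃y (s , s≃x) = s , ≃-trans {point s} {x} {y} s≃x x≃y

  B⊆Bad : B ⊆ Bad
  B⊆Bad {β} (s , s≃β) = Bad-respects-≃ {point s} {β} s≃β (point-bad s)

  code : (x : Maybe ℝ) → Maybe.All (_∈ B) x → ℕ → Bool
  -- An arbitrary value: the diagonal point can only be found at an index that holds an element.
  code nothing  _              = λ _ → true
  code (just _) (just (s , _)) = s

  code-point : ∀ x x∈B {y} → Maybe.Any (_≃ y) x → point (code x x∈B) ≃ y
  code-point (just x) (just (s , s≃x)) {y} (just x≃y) = ≃-trans {point s} {x} {y} s≃x x≃y

  -- Cantor's diagonal argument on codes: `point-injective` turns equality of reals into agreement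
  -- of sequences, which fails at the index of the diagonal point.
  B-uncountable : Uncountable B
  B-uncountable (e , e∈B , surjective) =
    let n , e≃d = surjective (point diagonal) (diagonal , ≃-refl {point diagonal})
    in not-¬ refl (point-injective {code (e n) (e∈B n)} {diagonal} (code-point (e n) (e∈B n) {point diagonal} e≃d) n)
    where
    diagonal : ℕ → Bool
    diagonal n = not (code (e n) (e∈B n) n)

theorem3 : (φ : Sequence)
    (φ-pos : ∀ q .{{_ : NonZero q}} → 0ℝ < φ q)
    (φ-noninc : ∀ p q .{{_ : NonZero p}} .{{_ : NonZero q}} → p ℕ.≤ q → φ q ≤ φ p) →
    φ 1 ≃ 1ℝ →
    φ ⟶ 0ℝ →
    (λ q → fromℕ q * φ q) ⟶+∞ →
    (M : ℝ) → 0ℝ < M →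
    (A : Pred ℝ 0ℓ) → A Respects _≃_ → Countable A → A ⊆ Bad →
    A ⊆ PartialQuotientsBoundedBy M →
    ∃ λ (B : Pred ℝ 0ℓ) → B Respects _≃_ × B ⊆ Bad × Uncountable B ×
    (∀ α β → α ∈ A → β ∈ B → InfinitelyManyPositive (λ q →
    fromℕ q * ‖ fromℕ q * α ‖ * ‖ fromℕ q * β ‖
    ≤ recip (fromℕ q * φ q) (0<x*y {fromℕ q} {φ q} (0<q q) (φ-pos q)))) ×
    EffectivelyConstructed B
theorem3 φ φ-pos _ _ φ⟶0 _ M _ A _ countable _ A⊆ =
  B , (λ {x} {y} → B-respects-≃ {x} {y}) , (λ {x} → B⊆Bad {x}) , B-uncountable ,
  (λ α β α∈A (s , s≃β) → infinitely-approximable {α} {β} s α∈A s≃β) ,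
  point , (λ {s} {t} → point-cong {s} {t}) , (λ s → s , ≃-refl {point s}) , λ _ β∈B → β∈B
  where open Littlewood φ φ-pos φ⟶0 M A countable A⊆
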